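{- Let $\alpha,\beta\in\mathbb{R}$ satisfy $\alpha\ge 0$, $\alpha+\beta\ge 0$ and $(\alpha,\beta)\neq(0,0)$. Then for every integer $n\ge 2$, $$F_n^{(\alpha,\beta)}(x)\preceq F_{n+1}^{(\alpha,\beta)}(x),$$ that is, $F_n^{(\alpha,\beta)}(x)$ interlaces $F_{n+1}^{(\alpha,\beta)}(x)$.
   Context: For $n\ge 0$ let $$N_{A_n}(x)=\frac{1}{n+1}\sum_{k=0}^{n}\binom{n+1}{k}\binom{n+1}{k+1}x^k,\qquad N_{B_n}(x)=\sum_{k=0}^n\binom{n}{k}^2x^k,$$ and for $n\ge 2$ and $\alpha,\beta\in\mathbb{R}$ let $$F_n^{(\alpha,\beta)}(x)=\alpha N_{B_n}(x)+\beta\, n x\, N_{A_{n-2}}(x).$$ Interlacing: for two polynomials $f(x),g(x)$ with real coefficients, positive leading coefficients and only real zeros, $g$ interlaces $f$, written $g\preceq f$, if $\cdots\le s_2\le r_2\le s_1\le r_1$, where $r_1\ge r_2\ge\cdots$ are all the zeros of $f$ and $s_1\ge s_2\ge\cdots$ all the zeros of $g$, counted with multiplicity (so $\deg f=\deg g$ or $\deg f=\deg g+1$). In particular the relation $g\preceq f$ includes the assertion that $f$ and $g$ have only real zeros. -}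

module Defs where

open import Level using (Level; _⊔_) renaming (suc to lsuc)
open import Algebra.Bundles using (CommutativeRing)
open import Algebra.Core using (Op₁)
import Algebra.Definitions.RawMonoid as Multiples
open import Data.List.Base using (List; []; _∷_; map; foldr; applyUpTo; length)
open import Data.List.Relation.Unary.Linked using (Linked)
open import Data.Nat.Base using (ℕ; zero; suc; _∸_)
open import Data.Nat.Combinatorics using (_C_)
open import Data.Product.Base using (_×_; ∃; ∃₂)
open import Data.Sum.Base using (_⊎_)
open import Relation.Binary.Core using (Rel)
open import Relation.Binary.PropositionalEquality.Core using (_≡_)
open import Relation.Binary.Structures using (IsDecTotalOrder)
open import Relation.Nullary.Negation.Core using (¬_)
open import Relation.Unary using (Pred)

module _ {a ℓ p} {A : Set a} (_≤_ : Rel A ℓ) (P : Pred A p) where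

  IsUpperBound : A → Set (a ⊔ ℓ ⊔ p)
  IsUpperBound u = ∀ x → P x → x ≤ u

  IsLeastUpperBound : A → Set (a ⊔ ℓ ⊔ p)
  IsLeastUpperBound s = IsUpperBound s × (∀ u → IsUpperBound u → s ≤ u)

-- The field of real numbers, given by its classical axioms: a Dedekind-complete
-- totally ordered field.  Up to isomorphism there is exactly one.  The order
-- and the equality are decidable because the reals meant here are the classical
-- ones.  The value of the inverse at 0# is unspecified.
record RealField c ℓ₁ ℓ₂ : Set (lsuc (c ⊔ ℓ₁ ⊔ ℓ₂)) where
  field
    commutativeRing : CommutativeRing c ℓ₁

  open CommutativeRing commutativeRing public

  infix 4 _≤_ _<_ _≥_
  infix 8 _⁻¹

  field
    0≉1             : ¬ (0# ≈ 1#)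
    _⁻¹             : Op₁ Carrier
    ⁻¹-inverseʳ     : ∀ x → ¬ (x ≈ 0#) → x * x ⁻¹ ≈ 1#
    _≤_             : Rel Carrier ℓ₂
    isDecTotalOrder : IsDecTotalOrder _≈_ _≤_
    +-monoˡ-≤       : ∀ {x y} z → x ≤ y → x + z ≤ y + z
    *-nonNegative   : ∀ {x y} → 0# ≤ x → 0# ≤ y → 0# ≤ x * y
    supremum        : (P : Pred Carrier (c ⊔ ℓ₁ ⊔ ℓ₂)) →
                      ∃ P → ∃ (IsUpperBound _≤_ P) → ∃ (IsLeastUpperBound _≤_ P)

  _<_ : Rel Carrier (ℓ₁ ⊔ ℓ₂)
  x < y = x ≤ y × ¬ (x ≈ y)

  _≥_ : Rel Carrier ℓ₂
  x ≥ y = y ≤ x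

  fromℕ : ℕ → Carrier
  fromℕ n = Multiples._×_ +-rawMonoid n 1#

module Polynomials {c ℓ} (R : CommutativeRing c ℓ) where

  open CommutativeRing R

  infix  4 _≈ᴾ_
  infixl 6 _+ᴾ_
  infixl 7 _*ᴾ_
  infixr 7 _·ᴾ_

  -- The coefficients in ascending order of degree.  Trailing zeros are allowed,
  -- so polynomials are compared by _≈ᴾ_.
  Poly : Set c
  Poly = List Carrier

  coeff : Poly → ℕ → Carrier
  coeff []      _       = 0#
  coeff (a ∷ p) zero    = a
  coeff (a ∷ p) (suc k) = coeff p k

  _≈ᴾ_ : Rel Poly ℓ
  p ≈ᴾ q = ∀ k → coeff p k ≈ coeff q k

  _+ᴾ_ : Poly → Poly → Poly
  []      +ᴾ q       = q
  (a ∷ p) +ᴾ []      = a ∷ p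
  (a ∷ p) +ᴾ (b ∷ q) = a + b ∷ p +ᴾ q

  _·ᴾ_ : Carrier → Poly → Poly
  a ·ᴾ p = map (a *_) p

  X·_ : Poly → Poly
  X· p = 0# ∷ p

  _*ᴾ_ : Poly → Poly → Poly
  []      *ᴾ q = []
  (a ∷ p) *ᴾ q = a ·ᴾ q +ᴾ X· (p *ᴾ q)

  X-_ : Carrier → Poly
  X- r = - r ∷ 1# ∷ []

  ∏[X-_] : List Carrier → Poly
  ∏[X-_] = foldr (λ r p → (X- r) *ᴾ p) (1# ∷ [])

alternate : ∀ {a} {A : Set a} → List A → List A → List A
alternate []       ss = ss
alternate (r ∷ rs) ss = r ∷ alternate ss rs

module Interlacing {c ℓ₁ ℓ₂} (ℝ : RealField c ℓ₁ ℓ₂) where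

  open RealField ℝ
  open Polynomials commutativeRing public

  infix 4 _≼_

  -- f has positive leading coefficient and only real zeros, and rs lists all of
  -- them with multiplicity: f = a (X - r₁) ⋯ (X - rₘ) with a > 0.  The product
  -- is monic, so a is the leading coefficient of f.
  HasZeros : Poly → List Carrier → Set (c ⊔ ℓ₁ ⊔ ℓ₂)
  HasZeros f rs = ∃ λ a → 0# < a × f ≈ᴾ a ·ᴾ ∏[X- rs ]

  -- r₁ ≥ s₁ ≥ r₂ ≥ s₂ ≥ ⋯.  In particular rs and ss are in descending order.
  Interlace : List Carrier → List Carrier → Set (c ⊔ ℓ₂)
  Interlace ss rs =
    (length rs ≡ length ss ⊎ length rs ≡ suc (length ss)) ×
    Linked _≥_ (alternate rs ss)

  _≼_ : Poly → Poly → Set (c ⊔ ℓ₁ ⊔ ℓ₂)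
  g ≼ f = ∃₂ λ ss rs → HasZeros g ss × HasZeros f rs × Interlace ss rs

module Narayana {c ℓ₁ ℓ₂} (ℝ : RealField c ℓ₁ ℓ₂) where

  open RealField ℝ
  open Polynomials commutativeRing

  N-A : ℕ → Poly
  N-A n = fromℕ (suc n) ⁻¹ ·ᴾ
          applyUpTo (λ k → fromℕ (suc n C k) * fromℕ (suc n C suc k)) (suc n)

  N-B : ℕ → Poly
  N-B n = applyUpTo (λ k → fromℕ (n C k) * fromℕ (n C k)) (suc n)

  -- Meant for n ≥ 2 only, where n ∸ 2 is the true difference.
  F : Carrier → Carrier → ℕ → Poly
  F α β n = α ·ᴾ N-B n +ᴾ (β * fromℕ n) ·ᴾ X· N-A (n ∸ 2)

{-# OPTIONS --safe #-}
-- Write T = 1 + x, B = N_{B_m}, U = (m + 1) ∑ₖ C(m,k−1) C(m,k) xᵏ, so that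
-- (m + 1) B⁺ = (m + 1) T B + 2 U and U⁺ = T U + 2 (m + 1) x B, and m (m + 1) F_{m+1} is
-- m (m + 1) α T B + g U with g = 2αm + β(m + 1) ≥ 0.  The sign of U alternates along
-- the zeros of B, hence so does that of F_{m+1}, whose zeros therefore
-- interlace those of B.  At a zero of F_{m+1} eliminating U gives
-- g F_{m+2} = −(positive) E B with E explicit.  If E < 0 there, then T² is large
-- compared with −x, where an inductive bound on U/B shows F_{m+1} ≠ 0.  So E ≥ 0
-- and the sign of F_{m+2} alternates along the zeros of F_{m+1}.  The argument
-- needs g > 0, which fails only for m = 1, α + β = 0.
module Submission where

-- The pair (B, U) is used because it is closed under n ↦ n + 1: the step is linear, and its
-- determinant is a positive multiple of (1 - x)², which does not vanish for x ≤ 0. This one fact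
-- makes B and U coprime there and carries the alternation of U from one index to the next. The
-- obstacle is that E has no fixed sign. For α > 0 and β large against α its second term is
-- negative, and then E < 0 for negative x close to 0 or far from 0. Elimination alone cannot settle
-- these x: one must know that F has no zero there, and this is why a separate estimate of U by B is
-- needed. All sign conditions along the zeros are weak, because consecutive F may share a zero; for
-- α = 0 they all vanish at 0. Only the points at which signs are sampled must be distinct. For the
-- zeros of F this comes from g > 0: a multiple zero of F would also be a zero of B, hence of U.

open import Defs
open import Algebra.Bundles using (CommutativeRing)
open import Data.Empty using (⊥; ⊥-elim)
open import Data.List.Base using (List; []; _∷_; applyUpTo; length)
open import Data.List.Relation.Unary.All as All using (All; []; _∷_)
open import Data.List.Relation.Unary.AllPairs using (AllPairs; []; _∷_)
open import Data.List.Relation.Unary.Linked as Linked using (Linked; [-]; _∷_)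
open import Data.Nat.Base as ℕ using (ℕ; zero; suc; s≤s; z≤n) renaming (_≤_ to _≤ℕ_; _<_ to _<ℕ_)
open import Data.Nat.Combinatorics using (_C_; nC1≡n; nCn≡1; nCk+nC[k+1]≡[n+1]C[k+1]; k>n⇒nCk≡0)
import Data.Nat.Properties as ℕ
open import Data.Product.Base using (_×_; _,_; proj₁; proj₂; ∃; ∃₂)
open import Data.Sum.Base using (_⊎_; inj₁; inj₂)
open import Data.Unit.Polymorphic.Base using (⊤; tt)
open import Level using (_⊔_; Lift; lift; lower)
open import Relation.Binary.PropositionalEquality.Core as ≡ using (_≡_)
open import Relation.Binary.Structures using (IsDecTotalOrder)
open import Relation.Nullary.Decidable using (yes; no)
open import Relation.Nullary.Negation.Core using (¬_)

-- Ring identities with integer coefficients.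

-- The coefficients are integers rather than elements of R because the solver
-- cancels terms only if equality of coefficients computes.
module IntegerSolver {c ℓ} (R : CommutativeRing c ℓ) where

  open CommutativeRing R
  open import Algebra.Properties.Semiring.Mult.TCOptimised semiring
    using (×-homo-+; ×1-homo-*; 1+×) renaming (_×_ to _·_)
  open import Algebra.Properties.Ring ring
    using (-0#≈0#; -‿involutive; -‿distribˡ-*; -‿distribʳ-*)
  open import Algebra.Properties.AbelianGroup +-abelianGroup
    using (⁻¹-∙-comm)
  open import Algebra.Solver.Ring.AlmostCommutativeRing
    using (fromCommutativeRing; _-Raw-AlmostCommutative⟶_)
  open import Data.Integer.Base as ℤ using (ℤ; +_; -[1+_]; _⊖_)
  import Data.Integer.Properties as ℤ
  open import Data.Maybe.Base using (just; nothing)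
  open import Relation.Binary.Definitions using (WeaklyDecidable)
  open import Relation.Binary.Reasoning.Setoid setoid

  -- With the optimised multiples 1 and 2 compute to `1#` and `1# + 1#`, so `:1` and `:2` match the
  -- terms of a goal definitionally. `fromℕ` is built from the plain multiples: `fromℕ (suc n)` is
  -- `1# + fromℕ n` and is entered as `:1 :+ n`.
  fromℤ : ℤ → Carrier
  fromℤ (+ n)    = n · 1#
  fromℤ -[1+ n ] = - (suc n · 1#)

  fromℤ-neg : ∀ i → fromℤ (ℤ.- i) ≈ - fromℤ i
  fromℤ-neg (+ zero)  = sym -0#≈0#
  fromℤ-neg (+ suc n) = refl
  fromℤ-neg -[1+ n ]  = sym (-‿involutive _)

  fromℤ-⊖ : ∀ m n → fromℤ (m ⊖ n) ≈ m · 1# - n · 1#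
  fromℤ-⊖ m       zero    = sym (trans (+-congˡ -0#≈0#) (+-identityʳ _))
  fromℤ-⊖ zero    (suc n) = sym (+-identityˡ _)
  fromℤ-⊖ (suc m) (suc n) = begin
    fromℤ (suc m ⊖ suc n)              ≡⟨ ≡.cong fromℤ (ℤ.[1+m]⊖[1+n]≡m⊖n m n) ⟩
    fromℤ (m ⊖ n)                      ≈⟨ fromℤ-⊖ m n ⟩
    m · 1# - n · 1#                    ≈⟨ +-congʳ (+-identityˡ _) ⟨
    0# + m · 1# - n · 1#               ≈⟨ +-congʳ (+-congʳ (-‿inverseʳ 1#)) ⟨
    1# - 1# + m · 1# - n · 1#          ≈⟨ +-congʳ (trans (+-assoc _ _ _) (trans (+-congˡ (+-comm _ _)) (sym (+-assoc _ _ _)))) ⟩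
    1# + m · 1# - 1# - n · 1#          ≈⟨ +-assoc _ _ _ ⟩
    1# + m · 1# + (- 1# - n · 1#)      ≈⟨ +-congˡ (⁻¹-∙-comm _ _) ⟩
    1# + m · 1# - (1# + n · 1#)        ≈⟨ +-cong (1+× m 1#) (-‿cong (1+× n 1#)) ⟨
    suc m · 1# - suc n · 1#            ∎

  fromℤ-+ : ∀ i j → fromℤ (i ℤ.+ j) ≈ fromℤ i + fromℤ j
  fromℤ-+ (+ m)    (+ n)    = ×-homo-+ 1# m n
  fromℤ-+ (+ m)    -[1+ n ] = fromℤ-⊖ m (suc n)
  fromℤ-+ -[1+ m ] (+ n)    = trans (fromℤ-⊖ n (suc m)) (+-comm _ _)
  fromℤ-+ -[1+ m ] -[1+ n ] = begin
    fromℤ (-[1+ m ] ℤ.+ -[1+ n ])            ≡⟨ ≡.cong fromℤ (ℤ.neg-distrib-+ (+ suc m) (+ suc n)) ⟨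
    fromℤ (ℤ.- (+ (suc m ℕ.+ suc n)))         ≈⟨ -‿cong (×-homo-+ 1# (suc m) (suc n)) ⟩
    - (suc m · 1# + suc n · 1#)              ≈⟨ ⁻¹-∙-comm _ _ ⟨
    - (suc m · 1#) - suc n · 1#              ∎

  fromℤ-*⁺ : ∀ m j → fromℤ (+ m ℤ.* j) ≈ m · 1# * fromℤ j
  fromℤ-*⁺ m (+ n)    = trans (reflexive (≡.cong fromℤ (≡.sym (ℤ.pos-* m n)))) (×1-homo-* m n)
  fromℤ-*⁺ m -[1+ n ] = begin
    fromℤ (+ m ℤ.* ℤ.- + suc n)    ≡⟨ ≡.cong fromℤ (ℤ.neg-distribʳ-* (+ m) (+ suc n)) ⟨
    fromℤ (ℤ.- (+ m ℤ.* + suc n))  ≈⟨ fromℤ-neg (+ m ℤ.* + suc n) ⟩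
    - fromℤ (+ m ℤ.* + suc n)      ≈⟨ -‿cong (fromℤ-*⁺ m (+ suc n)) ⟩
    - (m · 1# * suc n · 1#)        ≈⟨ -‿distribʳ-* _ _ ⟩
    m · 1# * - (suc n · 1#)        ∎

  fromℤ-* : ∀ i j → fromℤ (i ℤ.* j) ≈ fromℤ i * fromℤ j
  fromℤ-* (+ m)    j = fromℤ-*⁺ m j
  fromℤ-* -[1+ m ] j = begin
    fromℤ (ℤ.- + suc m ℤ.* j)      ≡⟨ ≡.cong fromℤ (ℤ.neg-distribˡ-* (+ suc m) j) ⟨
    fromℤ (ℤ.- (+ suc m ℤ.* j))    ≈⟨ fromℤ-neg (+ suc m ℤ.* j) ⟩
    - fromℤ (+ suc m ℤ.* j)        ≈⟨ -‿cong (fromℤ-*⁺ (suc m) j) ⟩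
    - (suc m · 1# * fromℤ j)       ≈⟨ -‿distribˡ-* _ _ ⟩
    - (suc m · 1#) * fromℤ j       ∎

  morphism : ℤ.+-*-rawRing -Raw-AlmostCommutative⟶ fromCommutativeRing R
  morphism = record
    { ⟦_⟧    = fromℤ
    ; +-homo = fromℤ-+
    ; *-homo = fromℤ-*
    ; -‿homo = fromℤ-neg
    ; 0-homo = refl
    ; 1-homo = refl
    }

  _coeff≟_ : WeaklyDecidable (λ i j → fromℤ i ≈ fromℤ j)
  i coeff≟ j with i ℤ.≟ j
  ... | yes ≡.refl = just refl
  ... | no  _      = nothing

  open import Algebra.Solver.Ring ℤ.+-*-rawRing (fromCommutativeRing R) morphism _coeff≟_ public

  :0 :1 :2 : ∀ {n} → Polynomial n
  :0 = con (+ 0)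
  :1 = con (+ 1)
  :2 = con (+ 2)

-- Ordered field arithmetic and certificates for equations.

module OrderedField {c ℓ₁ ℓ₂} (ℝ : RealField c ℓ₁ ℓ₂) where

  open RealField ℝ
  open IntegerSolver commutativeRing public using (solve; _:=_; _:+_; _:*_; _:-_; :-_; :0; :1; :2)
  module ≤ = IsDecTotalOrder isDecTotalOrder
  open import Algebra.Properties.Ring ring public using (-0#≈0#)

  2# : Carrier
  2# = 1# + 1#

  ≥0-resp : ∀ {x y} → 0# ≤ x → x ≈ y → 0# ≤ y
  ≥0-resp 0≤x x≈y = ≤.≤-respʳ-≈ x≈y 0≤x

  >0-resp : ∀ {x y} → 0# < x → x ≈ y → 0# < y
  >0-resp (0≤x , 0≉x) x≈y = ≥0-resp 0≤x x≈y , λ 0≈y → 0≉x (trans 0≈y (sym x≈y))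

  ≤⇒0≤- : ∀ {x y} → x ≤ y → 0# ≤ y - x
  ≤⇒0≤- {x} x≤y = ≤.≤-respˡ-≈ (-‿inverseʳ x) (+-monoˡ-≤ (- x) x≤y)

  0≤-⇒≤ : ∀ {x y} → 0# ≤ y - x → x ≤ y
  0≤-⇒≤ {x} {y} 0≤y-x = ≤.≤-respˡ-≈ (+-identityˡ x)
    (≤.≤-respʳ-≈ (solve 2 (λ y x → y :- x :+ x := y) refl y x) (+-monoˡ-≤ x 0≤y-x))

  +-nonNeg : ∀ {x y} → 0# ≤ x → 0# ≤ y → 0# ≤ x + y
  +-nonNeg {x} {y} 0≤x 0≤y =
    ≤.trans 0≤y (≤.≤-respˡ-≈ (+-identityˡ y) (+-monoˡ-≤ y 0≤x))

  +-pos-nonNeg : ∀ {x y} → 0# < x → 0# ≤ y → 0# < x + y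
  +-pos-nonNeg {x} {y} (0≤x , 0≉x) 0≤y = +-nonNeg 0≤x 0≤y , λ 0≈x+y →
    0≉x (≤.antisym 0≤x (0≤-⇒≤ (≥0-resp 0≤y (trans
      (solve 2 (λ x y → y := x :+ y :- x) refl x y) (+-congʳ (sym 0≈x+y))))))

  0≤x² : ∀ x → 0# ≤ x * x
  0≤x² x with ≤.total 0# x
  ... | inj₁ 0≤x = *-nonNegative 0≤x 0≤x
  ... | inj₂ x≤0 = ≥0-resp (*-nonNegative 0≤-x 0≤-x)
    (solve 1 (λ x → (:0 :- x) :* (:0 :- x) := x :* x) refl x)
    where
    0≤-x : 0# ≤ 0# - x
    0≤-x = ≤⇒0≤- x≤0

  0<1 : 0# < 1#
  0<1 = ≥0-resp (0≤x² 1#) (*-identityˡ 1#) , 0≉1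

  x*y≈0⇒y≈0 : ∀ {x y} → ¬ x ≈ 0# → x * y ≈ 0# → y ≈ 0#
  x*y≈0⇒y≈0 {x} {y} x≉0 xy≈0 = trans (trans (sym (*-identityˡ y))
    (trans (*-congʳ (sym (⁻¹-inverseʳ x x≉0)))
      (solve 3 (λ x y z → x :* z :* y := z :* (x :* y)) refl x y (x ⁻¹))))
    (trans (*-congˡ xy≈0) (zeroʳ _))

  ≉0 : ∀ {x} → 0# < x → ¬ x ≈ 0#
  ≉0 (_ , 0≉x) x≈0 = 0≉x (sym x≈0)

  *-pos : ∀ {x y} → 0# < x → 0# < y → 0# < x * y
  *-pos 0<x 0<y = *-nonNegative (proj₁ 0<x) (proj₁ 0<y) , λ 0≈xy →
    ≉0 0<y (x*y≈0⇒y≈0 (≉0 0<x) (sym 0≈xy))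

  sign : ∀ x → 0# ≤ x ⊎ 0# < - x
  sign x with 0# ≤.≤? x
  ... | yes 0≤x = inj₁ 0≤x
  ... | no  0≰x with ≤.total 0# x
  ...   | inj₁ 0≤x = ⊥-elim (0≰x 0≤x)
  ...   | inj₂ x≤0 = inj₂ (≥0-resp (≤⇒0≤- x≤0) (+-identityˡ _) , λ 0≈-x →
    0≰x (≤.reflexive (sym (trans (sym (+-identityʳ x)) (trans (+-congˡ 0≈-x) (-‿inverseʳ x))))))

  >0-or-≈0 : ∀ {x} → 0# ≤ x → 0# < x ⊎ x ≈ 0#
  >0-or-≈0 {x} 0≤x with 0# ≤.≟ x
  ... | yes 0≈x = inj₂ (sym 0≈x)
  ... | no  0≉x = inj₁ (0≤x , 0≉x)

  ¬[x≥0∧-x>0] : ∀ {x} → 0# ≤ x → ¬ 0# < - x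
  ¬[x≥0∧-x>0] {x} 0≤x 0<-x = proj₂ (+-pos-nonNeg 0<-x 0≤x) (sym (-‿inverseˡ x))

  *-cancelˡ-nonNeg : ∀ {k x} → 0# < k → 0# ≤ k * x → 0# ≤ x
  *-cancelˡ-nonNeg {k} {x} 0<k 0≤kx with sign x
  ... | inj₁ 0≤x  = 0≤x
  ... | inj₂ 0<-x = ⊥-elim (¬[x≥0∧-x>0] 0≤kx
    (>0-resp (*-pos 0<k 0<-x) (solve 2 (λ k x → k :* (:- x) := :- (k :* x)) refl k x)))

  *-cancelˡ-pos : ∀ {k x} → 0# ≤ k → 0# < k * x → 0# < x
  *-cancelˡ-pos {k} {x} 0≤k 0<kx with sign (- x)
  ... | inj₁ 0≤-x  = ⊥-elim (¬[x≥0∧-x>0] (*-nonNegative 0≤k 0≤-x)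
    (>0-resp 0<kx (solve 2 (λ k x → k :* x := :- (k :* (:- x))) refl k x)))
  ... | inj₂ 0<--x = >0-resp 0<--x (solve 1 (λ x → :- (:- x) := x) refl x)

  -- A certificate: writing x - y as a multiple of a - b is a polynomial identity, which the solver
  -- checks. Most eliminations below have this form or that of `lincomb₂`.
  lincomb : ∀ {a b k x y} → a ≈ b → x - y ≈ k * (a - b) → x ≈ y
  lincomb {a} {b} {k} {x} {y} a≈b x-y≈k[a-b] =
    trans (solve 2 (λ x y → x := x :- y :+ y) refl x y)
      (trans (+-congʳ (trans x-y≈k[a-b] (trans (*-congˡ (trans (+-congʳ a≈b) (-‿inverseʳ b))) (zeroʳ k))))
        (+-identityˡ y))

  lincomb₂ : ∀ {a b c d k l x y} → a ≈ b → c ≈ d → x - y ≈ k * (a - b) + l * (c - d) → x ≈ y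
  lincomb₂ {a} {b} {c} {d} {k} {l} {x} {y} a≈b c≈d e = lincomb {k = k} a≈b
    (trans e (trans (+-congˡ (trans (*-congˡ (trans (+-congʳ c≈d) (-‿inverseʳ d))) (zeroʳ l))) (+-identityʳ _)))

  quotient : ∀ {n c} → 0# < n → 0# < c → ∃ λ d → 0# < d × n * d ≈ c
  quotient {n} {c} 0<n 0<c = n ⁻¹ * c , *-cancelˡ-pos (proj₁ 0<n) (>0-resp 0<c (sym e)) , e
    where
    e : n * (n ⁻¹ * c) ≈ c
    e = trans (sym (*-assoc _ _ _)) (trans (*-congʳ (⁻¹-inverseʳ n (≉0 0<n))) (*-identityˡ c))

  0<⇒≰ : ∀ {x d} → 0# < d → ¬ x + d ≤ x
  0<⇒≰ {x} {d} 0<d x+d≤x = ¬[x≥0∧-x>0] (≤⇒0≤- x+d≤x)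
    (>0-resp 0<d (solve 2 (λ x d → d := :- (x :- (x :+ d))) refl x d))

-- Evaluation, synthetic division and the intermediate value theorem.

module Evaluation {c ℓ₁ ℓ₂} (ℝ : RealField c ℓ₁ ℓ₂) where

  open RealField ℝ
  open Polynomials commutativeRing
  open OrderedField ℝ

  eval : Poly → Carrier → Carrier
  eval []      x = 0#
  eval (a ∷ p) x = a + x * eval p x

  coeff-+ᴾ : ∀ p q k → coeff (p +ᴾ q) k ≈ coeff p k + coeff q k
  coeff-+ᴾ []      q       k       = sym (+-identityˡ _)
  coeff-+ᴾ (a ∷ p) []      k       = sym (+-identityʳ _)
  coeff-+ᴾ (a ∷ p) (b ∷ q) zero    = refl
  coeff-+ᴾ (a ∷ p) (b ∷ q) (suc k) = coeff-+ᴾ p q k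

  coeff-·ᴾ : ∀ a p k → coeff (a ·ᴾ p) k ≈ a * coeff p k
  coeff-·ᴾ a []      k       = sym (zeroʳ a)
  coeff-·ᴾ a (b ∷ p) zero    = refl
  coeff-·ᴾ a (b ∷ p) (suc k) = coeff-·ᴾ a p k

  coeff-X-*ᴾ-zero : ∀ r p → coeff ((X- r) *ᴾ p) 0 ≈ - r * coeff p 0
  coeff-X-*ᴾ-zero r p = trans (coeff-+ᴾ (- r ·ᴾ p) _ 0)
    (trans (+-identityʳ _) (coeff-·ᴾ (- r) p 0))

  coeff-X-*ᴾ-suc : ∀ r p k → coeff ((X- r) *ᴾ p) (suc k) ≈ coeff p k - r * coeff p (suc k)
  coeff-X-*ᴾ-suc r p k = trans (coeff-+ᴾ (- r ·ᴾ p) _ (suc k))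
    (trans (+-cong (coeff-·ᴾ (- r) p (suc k))
                   (trans (coeff-+ᴾ (1# ·ᴾ p) (0# ∷ []) k)
                     (trans (+-cong (coeff-·ᴾ 1# p k) (coeff-0∷[] k)) (+-identityʳ _))))
           (solve 3 (λ r b c → (:- r) :* b :+ :1 :* c := c :- r :* b) refl r _ _))
    where
    coeff-0∷[] : ∀ k → coeff (0# ∷ []) k ≈ 0#
    coeff-0∷[] zero    = refl
    coeff-0∷[] (suc k) = refl

  eval-≈0 : ∀ p x → (∀ k → coeff p k ≈ 0#) → eval p x ≈ 0#
  eval-≈0 []      x p≈0 = refl
  eval-≈0 (a ∷ p) x p≈0 = trans (+-cong (p≈0 0)
    (trans (*-congˡ (eval-≈0 p x (λ k → p≈0 (suc k)))) (zeroʳ x))) (+-identityʳ _)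

  eval-cong : ∀ p q x → p ≈ᴾ q → eval p x ≈ eval q x
  eval-cong []      q       x p≈q = sym (eval-≈0 q x (λ k → sym (p≈q k)))
  eval-cong (a ∷ p) []      x p≈q = eval-≈0 (a ∷ p) x p≈q
  eval-cong (a ∷ p) (b ∷ q) x p≈q =
    +-cong (p≈q 0) (*-congˡ (eval-cong p q x (λ k → p≈q (suc k))))

  eval-+ᴾ : ∀ p q x → eval (p +ᴾ q) x ≈ eval p x + eval q x
  eval-+ᴾ []      q       x = sym (+-identityˡ _)
  eval-+ᴾ (a ∷ p) []      x = sym (+-identityʳ _)
  eval-+ᴾ (a ∷ p) (b ∷ q) x = lincomb (eval-+ᴾ p q x)
    (solve 6 (λ a b x s t u → (a :+ b) :+ x :* s :- ((a :+ x :* t) :+ (b :+ x :* u)) := x :* (s :- (t :+ u)))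
      refl a b x (eval (p +ᴾ q) x) (eval p x) (eval q x))

  eval-·ᴾ : ∀ a p x → eval (a ·ᴾ p) x ≈ a * eval p x
  eval-·ᴾ a []      x = sym (zeroʳ a)
  eval-·ᴾ a (b ∷ p) x = lincomb (eval-·ᴾ a p x)
    (solve 5 (λ a b x s t → a :* b :+ x :* s :- a :* (b :+ x :* t) := x :* (s :- a :* t))
      refl a b x (eval (a ·ᴾ p) x) (eval p x))

  eval-X-*ᴾ : ∀ r p x → eval ((X- r) *ᴾ p) x ≈ (x - r) * eval p x
  eval-X-*ᴾ r p x = trans (eval-+ᴾ (- r ·ᴾ p) _ x)
    (lincomb₂ (eval-·ᴾ (- r) p x)
      (trans (eval-+ᴾ (1# ·ᴾ p) (0# ∷ []) x) (+-congʳ (eval-·ᴾ 1# p x)))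
      (solve 5 (λ r x s t e →
          s :+ (:0 :+ x :* t) :- (x :- r) :* e
            := :1 :* (s :- (:- r) :* e) :+ x :* (t :- (:1 :* e :+ (:0 :+ x :* :0))))
        refl r x (eval (- r ·ᴾ p) x) (eval (1# ·ᴾ p +ᴾ (0# ∷ [])) x) (eval p x)))

  eval-factor : ∀ {p a rs} x → p ≈ᴾ a ·ᴾ ∏[X- rs ] → eval p x ≈ a * eval ∏[X- rs ] x
  eval-factor {p} {a} {rs} x p≈ = trans (eval-cong p (a ·ᴾ ∏[X- rs ]) x p≈) (eval-·ᴾ a ∏[X- rs ] x)

  X-*ᴾ-cong : ∀ r {p q} → p ≈ᴾ q → (X- r) *ᴾ p ≈ᴾ (X- r) *ᴾ q
  X-*ᴾ-cong r {p} {q} p≈q zero = trans (coeff-X-*ᴾ-zero r p)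
    (trans (*-congˡ (p≈q 0)) (sym (coeff-X-*ᴾ-zero r q)))
  X-*ᴾ-cong r {p} {q} p≈q (suc k) = trans (coeff-X-*ᴾ-suc r p k)
    (trans (+-cong (p≈q k) (-‿cong (*-congˡ (p≈q (suc k))))) (sym (coeff-X-*ᴾ-suc r q k)))

  X-*ᴾ-·ᴾ : ∀ r a p → (X- r) *ᴾ (a ·ᴾ p) ≈ᴾ a ·ᴾ ((X- r) *ᴾ p)
  X-*ᴾ-·ᴾ r a p zero = trans (coeff-X-*ᴾ-zero r (a ·ᴾ p))
    (trans (*-congˡ (coeff-·ᴾ a p 0)) (trans
      (solve 3 (λ r a e → (:- r) :* (a :* e) := a :* ((:- r) :* e)) refl r a _)
      (sym (trans (coeff-·ᴾ a ((X- r) *ᴾ p) 0) (*-congˡ (coeff-X-*ᴾ-zero r p))))))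
  X-*ᴾ-·ᴾ r a p (suc k) = trans (coeff-X-*ᴾ-suc r (a ·ᴾ p) k)
    (trans (+-cong (coeff-·ᴾ a p k) (-‿cong (*-congˡ (coeff-·ᴾ a p (suc k))))) (trans
      (solve 4 (λ r a d e → a :* d :- r :* (a :* e) := a :* (d :- r :* e)) refl r a _ _)
      (sym (trans (coeff-·ᴾ a ((X- r) *ᴾ p) (suc k)) (*-congˡ (coeff-X-*ᴾ-suc r p k))))))

  -- Synthetic division of p - p(r) by X - r, for any r, from the identity (a + x p(x)) - (a + r
  -- p(r)) = (x - r) p(r) + x (p(x) - p(r)). The list keeps its length, so a nonempty quotient ends
  -- in the entry 0.
  quot : Poly → Carrier → Poly
  quot []      r = []
  quot (a ∷ p) r = eval p r ∷ quot p r

  eval-quot : ∀ p r x → eval p x - eval p r ≈ (x - r) * eval (quot p r) x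
  eval-quot []      r x = solve 2 (λ r x → :0 :- :0 := (x :- r) :* :0) refl r x
  eval-quot (a ∷ p) r x = lincomb (eval-quot p r x)
    (solve 6 (λ a r x s t q →
        (a :+ x :* s) :- (a :+ r :* t) :- (x :- r) :* (t :+ x :* q) := x :* (s :- t :- (x :- r) :* q))
      refl a r x (eval p x) (eval p r) (eval (quot p r) x))

  coeff-quot : ∀ p r k → coeff p k ≈ coeff (eval p r ∷ quot p r) k - r * coeff (quot p r) k
  coeff-quot []      r zero    = solve 1 (λ r → :0 := :0 :- r :* :0) refl r
  coeff-quot []      r (suc k) = solve 1 (λ r → :0 := :0 :- r :* :0) refl r
  coeff-quot (b ∷ p) r zero    = solve 3 (λ b r e → b := b :+ r :* e :- r :* e) refl b r (eval p r)
  coeff-quot (b ∷ p) r (suc k) = coeff-quot p r k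

  quot-correct : ∀ p r → eval p r ≈ 0# → p ≈ᴾ (X- r) *ᴾ quot p r
  quot-correct []      r _   k       = sym (coeff-X-*ᴾ-[] k)
    where
    coeff-X-*ᴾ-[] : ∀ k → coeff ((X- r) *ᴾ []) k ≈ 0#
    coeff-X-*ᴾ-[] zero    = trans (coeff-X-*ᴾ-zero r []) (zeroʳ _)
    coeff-X-*ᴾ-[] (suc k) = trans (coeff-X-*ᴾ-suc r [] k) (solve 1 (λ r → :0 :- r :* :0 := :0) refl r)
  quot-correct (a ∷ p) r e≈0 zero    = lincomb₂ e≈0 (coeff-X-*ᴾ-zero r (quot (a ∷ p) r))
    (solve 4 (λ a r e t → a :- t := :1 :* (a :+ r :* e :- :0) :+ (:- :1) :* (t :- (:- r) :* e))
      refl a r (eval p r) (coeff ((X- r) *ᴾ quot (a ∷ p) r) 0))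
  quot-correct (a ∷ p) r e≈0 (suc k) =
    trans (coeff-quot p r k) (sym (coeff-X-*ᴾ-suc r (quot (a ∷ p) r) k))

  -- Stated through `coeff` because trailing zeros make the length of the list say nothing about the
  -- degree.
  HasLeading : Carrier → ℕ → Poly → Set ℓ₁
  HasLeading a e p = coeff p e ≈ a × (∀ k → e <ℕ k → coeff p k ≈ 0#)

  quot-leading : ∀ {a} e p r → HasLeading a (suc e) p → HasLeading a e (quot p r)
  quot-leading e []      r (l , z) = l , λ k _ → refl
  quot-leading zero    (b ∷ p) r (l , z) =
      trans (eval-constant p (λ k → z (suc (suc k)) (s≤s (s≤s z≤n)))) l
    , λ { (suc k) _ → quot-constant p (λ k → z (suc (suc k)) (s≤s (s≤s z≤n))) k }
    where
    eval-constant : ∀ p → (∀ k → coeff p (suc k) ≈ 0#) → eval p r ≈ coeff p 0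
    eval-constant []      _ = refl
    eval-constant (a ∷ p) z = trans (+-congˡ (trans (*-congˡ (eval-≈0 p r z)) (zeroʳ r))) (+-identityʳ a)
    quot-≈0 : ∀ p → (∀ k → coeff p k ≈ 0#) → ∀ k → coeff (quot p r) k ≈ 0#
    quot-≈0 []      z k       = refl
    quot-≈0 (a ∷ p) z zero    = eval-≈0 p r (λ k → z (suc k))
    quot-≈0 (a ∷ p) z (suc k) = quot-≈0 p (λ k → z (suc k)) k
    quot-constant : ∀ p → (∀ k → coeff p (suc k) ≈ 0#) → ∀ k → coeff (quot p r) k ≈ 0#
    quot-constant []      z k       = refl
    quot-constant (a ∷ p) z zero    = eval-≈0 p r z
    quot-constant (a ∷ p) z (suc k) = quot-≈0 p z k
  quot-leading (suc e) (b ∷ p) r (l , z) with quot-leading e p r (l , λ k e<k → z (suc k) (s≤s e<k))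
  ... | l′ , z′ = l′ , λ { (suc k) (s≤s e<k) → z′ k e<k }

  -- This is |x| ≤ K without an absolute value.
  Bounds : Carrier → Carrier → Set ℓ₂
  Bounds K x = 0# ≤ K - x × 0# ≤ K + x

  bounds-∃ : ∀ x → ∃ λ K → Bounds K x × 0# ≤ K
  bounds-∃ x with sign x
  ... | inj₁ 0≤x  = x , (≥0-resp (≤.refl) (sym (-‿inverseʳ x)) , +-nonNeg 0≤x 0≤x) , 0≤x
  ... | inj₂ (0≤-x , _) = - x , (+-nonNeg 0≤-x 0≤-x , ≥0-resp ≤.refl (sym (-‿inverseˡ x))) , 0≤-x

  bounds-+ : ∀ {K L x y} → Bounds K x → Bounds L y → Bounds (K + L) (x + y)
  bounds-+ {K} {L} {x} {y} (a , b) (c , d) =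
      ≥0-resp (+-nonNeg a c) (solve 4 (λ K L x y → K :- x :+ (L :- y) := K :+ L :- (x :+ y)) refl K L x y)
    , ≥0-resp (+-nonNeg b d) (solve 4 (λ K L x y → K :+ x :+ (L :+ y) := K :+ L :+ (x :+ y)) refl K L x y)

  0<2 : 0# < 2#
  0<2 = +-pos-nonNeg 0<1 (proj₁ 0<1)

  -- Products of the nonnegative numbers K ± x and L ± y, added in pairs, give 2 (K L - x y) and 2
  -- (K L + x y).
  bounds-* : ∀ {K L x y} → Bounds K x → Bounds L y → Bounds (K * L) (x * y)
  bounds-* {K} {L} {x} {y} (a , b) (c , d) =
      *-cancelˡ-nonNeg 0<2 (≥0-resp (+-nonNeg (*-nonNegative a d) (*-nonNegative b c))
        (solve 4 (λ K L x y → (K :- x) :* (L :+ y) :+ (K :+ x) :* (L :- y)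
                                := :2 :* (K :* L :- x :* y)) refl K L x y))
    , *-cancelˡ-nonNeg 0<2 (≥0-resp (+-nonNeg (*-nonNegative a c) (*-nonNegative b d))
        (solve 4 (λ K L x y → (K :- x) :* (L :- y) :+ (K :+ x) :* (L :+ y)
                                := :2 :* (K :* L :+ x :* y)) refl K L x y))

  eval-bounded : ∀ p K → ∃ λ M → ∀ x → Bounds K x → Bounds M (eval p x)
  eval-bounded []      K = 0# , λ x _ → ≥0-resp ≤.refl (sym (-‿inverseʳ 0#)) , ≥0-resp ≤.refl (sym (+-identityʳ 0#))
  eval-bounded (a ∷ p) K with bounds-∃ a | eval-bounded p K
  ... | A , |a|≤A , _ | M , |p|≤M = A + K * M , λ x |x|≤K → bounds-+ |a|≤A (bounds-* |x|≤K (|p|≤M x |x|≤K))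

  -- The 1 added to M makes N strictly positive. That M ≥ 0 is read off from |p(x)| ≤ M at a point
  -- of [s, u], so `0# < N` stands under the quantifier.
  eval-bounded-on : ∀ p s u → ∃ λ N → ∀ x → s ≤ x → x ≤ u → 0# < N × 0# ≤ N - eval p x
  eval-bounded-on p s u = M + 1# , λ x s≤x x≤u →
    let (a , b) = |p|≤M x (within x s≤x x≤u) in
      >0-resp (+-pos-nonNeg 0<1 (*-cancelˡ-nonNeg 0<2 (≥0-resp (+-nonNeg a b)
        (solve 2 (λ M e → M :- e :+ (M :+ e) := :2 :* M) refl M (eval p x))))) (+-comm _ _)
    , ≥0-resp (+-nonNeg a (proj₁ 0<1)) (solve 2 (λ M e → M :- e :+ :1 := M :+ :1 :- e) refl M (eval p x))
    where
    S = proj₁ (bounds-∃ s)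
    U = proj₁ (bounds-∃ u)
    M = proj₁ (eval-bounded p (S + U))
    |p|≤M = proj₂ (eval-bounded p (S + U))
    within : ∀ x → s ≤ x → x ≤ u → Bounds (S + U) x
    within x s≤x x≤u =
        ≥0-resp (+-nonNeg (proj₂ (proj₂ (bounds-∃ s))) (+-nonNeg (proj₁ (proj₁ (proj₂ (bounds-∃ u)))) (≤⇒0≤- x≤u)))
          (solve 4 (λ S U u x → S :+ (U :- u :+ (u :- x)) := S :+ U :- x) refl S U u x)
      , ≥0-resp (+-nonNeg (proj₂ (proj₂ (bounds-∃ u))) (+-nonNeg (proj₂ (proj₁ (proj₂ (bounds-∃ s)))) (≤⇒0≤- s≤x)))
          (solve 4 (λ S U s x → U :+ (S :+ s :+ (x :- s)) := S :+ U :+ x) refl S U s x)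

  -- The zero is the supremum r of {x ∈ [s,u] : p(x) ≤ 0}.  The difference
  -- quotient at r is bounded by some N on [s,u], so p keeps its sign at distance
  -- |p(r)|/N from r.
  module _ (p : Poly) (s u : Carrier) (s≤u : s ≤ u) (0<pu : 0# < eval p u) where

    -- `Lift` moves the set to the universe level over which `supremum` quantifies.
    NonPositive : Carrier → Set (c ⊔ ℓ₁ ⊔ ℓ₂)
    NonPositive x = Lift (c ⊔ ℓ₁ ⊔ ℓ₂) (s ≤ x × x ≤ u × 0# ≤ - eval p x)

    module _ (r N : Carrier) (s≤r : s ≤ r) (r≤u : r ≤ u) (0<N : 0# < N)
             (q≤N : ∀ x → s ≤ x → x ≤ u → 0# ≤ N - eval (quot p r) x) where

      supremum-≮0 : IsUpperBound _≤_ NonPositive r → ¬ 0# < - eval p r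
      supremum-≮0 upper pr<0 with quotient 0<N pr<0
      ... | d , 0<d , Nd≈-pr = 0<⇒≰ 0<d (upper (r + d) (lift (s≤r+d , r+d≤u , p[r+d]≤0)))
        where
        s≤r+d : s ≤ r + d
        s≤r+d = 0≤-⇒≤ (≥0-resp (+-nonNeg (≤⇒0≤- s≤r) (proj₁ 0<d))
          (solve 3 (λ r s d → r :- s :+ d := r :+ d :- s) refl r s d))
        -- With difference quotient at most N, the climb from p(r) to p(u) > 0 takes a distance of
        -- at least -p(r)/N = d.
        r+d≤u : r + d ≤ u
        r+d≤u = 0≤-⇒≤ (*-cancelˡ-nonNeg 0<N (≥0-resp
          (+-nonNeg (*-nonNegative (≤⇒0≤- r≤u) (q≤N u s≤u ≤.refl)) (proj₁ 0<pu))
          (lincomb₂ (eval-quot p r u) Nd≈-pr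
            (solve 7 (λ u r N d Q pu pr →
                (u :- r) :* (N :- Q) :+ pu :- N :* (u :- (r :+ d))
                  := :1 :* (pu :- pr :- (u :- r) :* Q) :+ :1 :* (N :* d :- (:- pr)))
              refl u r N d (eval (quot p r) u) (eval p u) (eval p r)))))
        p[r+d]≤0 : 0# ≤ - eval p (r + d)
        p[r+d]≤0 = ≥0-resp (*-nonNegative (proj₁ 0<d) (q≤N (r + d) s≤r+d r+d≤u))
          (lincomb₂ (eval-quot p r (r + d)) Nd≈-pr
            (solve 6 (λ r N d Q px pr →
                d :* (N :- Q) :- (:- px) := :1 :* (px :- pr :- (r :+ d :- r) :* Q) :+ :1 :* (N :* d :- (:- pr)))
              refl r N d (eval (quot p r) (r + d)) (eval p (r + d)) (eval p r)))

      supremum-≯0 : IsLeastUpperBound _≤_ NonPositive r → ¬ 0# < eval p r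
      supremum-≯0 (upper , least) 0<pr with quotient 0<N 0<pr
      ... | d , 0<d , Nd≈pr = 0<⇒≰ 0<d (≤.≤-respˡ-≈
        (solve 2 (λ r d → r := r :- d :+ d) refl r d) (least (r - d) upper′))
        where
        upper′ : ∀ x → NonPositive x → x ≤ r - d
        upper′ x x∈S@(lift (s≤x , x≤u , px≤0)) = 0≤-⇒≤ (*-cancelˡ-nonNeg 0<N (≥0-resp
          (+-nonNeg (*-nonNegative (≤⇒0≤- (upper x x∈S)) (q≤N x s≤x x≤u)) px≤0)
          (lincomb₂ (eval-quot p r x) Nd≈pr
            (solve 7 (λ x r N d Q px pr →
                (r :- x) :* (N :- Q) :+ (:- px) :- N :* (r :- d :- x)
                  := (:- :1) :* (px :- pr :- (x :- r) :* Q) :+ :1 :* (N :* d :- pr))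
              refl x r N d (eval (quot p r) x) (eval p x) (eval p r)))))

      supremum-≈0 : IsLeastUpperBound _≤_ NonPositive r → eval p r ≈ 0#
      supremum-≈0 lub with sign (eval p r)
      ... | inj₂ pr<0 = ⊥-elim (supremum-≮0 (proj₁ lub) pr<0)
      ... | inj₁ 0≤pr with >0-or-≈0 0≤pr
      ...   | inj₁ 0<pr = ⊥-elim (supremum-≯0 lub 0<pr)
      ...   | inj₂ pr≈0 = pr≈0

    intermediate-value : 0# < - eval p s → ∃ λ r → s ≤ r × r ≤ u × eval p r ≈ 0#
    intermediate-value ps<0 = zero-at
      (supremum NonPositive (s , s∈S) (u , λ x x∈S → proj₁ (proj₂ (lower x∈S))))
      where
      s∈S : NonPositive s
      s∈S = lift (≤.refl , s≤u , proj₁ ps<0)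
      zero-at : ∃ (IsLeastUpperBound _≤_ NonPositive) → ∃ λ r → s ≤ r × r ≤ u × eval p r ≈ 0#
      zero-at (r , upper , least) = r , s≤r , r≤u , supremum-≈0 r (proj₁ bound) s≤r r≤u
        (proj₁ (proj₂ bound r s≤r r≤u)) (λ x s≤x x≤u → proj₂ (proj₂ bound x s≤x x≤u)) (upper , least)
        where
        s≤r : s ≤ r
        s≤r = upper s s∈S
        r≤u : r ≤ u
        r≤u = least u (λ x x∈S → proj₁ (proj₂ (lower x∈S)))
        bound = eval-bounded-on (quot p r) s u

-- Zeros located by sign changes, and their interlacing.

module SignChanges {c ℓ₁ ℓ₂} (ℝ : RealField c ℓ₁ ℓ₂) where

  open RealField ℝ
  open Interlacing ℝ
  open OrderedField ℝ
  open Evaluation ℝ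

  -- u ≥ r₁ ≥ s₁ ≥ r₂ ≥ s₂ ≥ ⋯
  data Interleaved : Carrier → List Carrier → List Carrier → Set (c ⊔ ℓ₂) where
    []  : ∀ {u} → Interleaved u [] []
    _∷_ : ∀ {u r rs ss} → r ≤ u → Interleaved r ss rs → Interleaved u (r ∷ rs) ss

  interleaved-bound : ∀ {u v rs ss} → u ≤ v → Interleaved u rs ss → All (_≤ v) rs × All (_≤ v) ss
  interleaved-bound u≤v []        = [] , []
  interleaved-bound u≤v (r≤u ∷ i) with interleaved-bound (≤.trans r≤u u≤v) i
  ... | ss≤ , rs≤ = ≤.trans r≤u u≤v ∷ rs≤ , ss≤

  interleaved-length : ∀ {u rs ss} → Interleaved u rs ss →
                       length rs ≡ length ss ⊎ length rs ≡ suc (length ss)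
  interleaved-length []      = inj₁ ≡.refl
  interleaved-length (_ ∷ i) with interleaved-length i
  ... | inj₁ e = inj₂ (≡.cong suc (≡.sym e))
  ... | inj₂ e = inj₁ (≡.sym e)

  interleaved-linked : ∀ {u rs ss} → Interleaved u rs ss → Linked _≥_ (u ∷ alternate rs ss)
  interleaved-linked []        = [-]
  interleaved-linked (r≤u ∷ i) = r≤u ∷ interleaved-linked i

  interlace : ∀ {u rs ss} → Interleaved u rs ss → Interlace ss rs
  interlace i = interleaved-length i , Linked.tail (interleaved-linked i)

  Decreasing : List Carrier → Set (c ⊔ ℓ₁ ⊔ ℓ₂)
  Decreasing = AllPairs (λ x y → y < x)

  -- If two neighbouring entries of rs were equal, the entry of ss squeezed between them would equal
  -- them and inherit P.
  interleaved-decreasing : ∀ {p} (P : Carrier → Set p) → (∀ {x y} → x ≈ y → P x → P y) →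
                           ∀ {u rs ss} → Interleaved u rs ss → All P rs → All (λ s → ¬ P s) ss →
                           Decreasing rs
  interleaved-decreasing P resp []                  _        _          = []
  interleaved-decreasing P resp (_ ∷ [])            _        _          = [] ∷ []
  interleaved-decreasing P resp (_∷_ {r = r} _ (_∷_ {r = s} s≤r i)) (Pr ∷ Prs) (¬Ps ∷ ¬Pss) =
      All.map below (proj₁ (interleaved-bound ≤.refl i))
    ∷ interleaved-decreasing P resp i Prs ¬Pss
    where
    below : ∀ {x} → x ≤ s → x < r
    below x≤s = ≤.trans x≤s s≤r , λ x≈r →
      ¬Ps (resp (≤.antisym (≤.trans (≤.reflexive (sym x≈r)) x≤s) s≤r) Pr)

  -- The signs are weak, so f may vanish at some of the points.
  Alternates : (Carrier → Carrier) → List Carrier → Set ℓ₂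
  Alternates f []       = ⊤
  Alternates f (s ∷ ss) = 0# ≤ f s × Alternates (λ x → - f x) ss

  -- A weak sign passes from f(x) to g(x). The scalars may depend on x, and the factor k spares a
  -- division.
  Follows : (Carrier → Carrier) → (Carrier → Carrier) → Carrier → Set (c ⊔ ℓ₁ ⊔ ℓ₂)
  Follows f g x = ∃₂ λ k l → 0# < k × 0# ≤ l × k * g x ≈ l * f x

  follows-neg : ∀ {f g x} → Follows f g x → Follows (λ x → - f x) (λ x → - g x) x
  follows-neg {f} {g} {x} (k , l , 0<k , 0≤l , e) = k , l , 0<k , 0≤l , lincomb e
    (solve 4 (λ k l f g → k :* (:- g) :- l :* (:- f) := (:- :1) :* (k :* g :- l :* f)) refl k l (f x) (g x))

  alternates-follows : ∀ {f g ss} → All (Follows f g) ss → Alternates f ss → Alternates g ss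
  alternates-follows                 []                            _        = tt
  alternates-follows {f} {g} {s ∷ _} ((k , l , 0<k , 0≤l , e) ∷ fs) (0≤f , a) =
      *-cancelˡ-nonNeg 0<k (≥0-resp (*-nonNegative 0≤l 0≤f) (sym e))
    , alternates-follows (All.map (λ {x} → follows-neg {f} {g} {x}) fs) a

  ∏-nonNeg : ∀ {rs x} → All (_≤ x) rs → 0# ≤ eval ∏[X- rs ] x
  ∏-nonNeg {x = x}     []         = ≥0-resp (proj₁ 0<1) (solve 1 (λ x → :1 := :1 :+ x :* :0) refl x)
  ∏-nonNeg {r ∷ rs} {x} (r≤x ∷ rs≤) =
    ≥0-resp (*-nonNegative (≤⇒0≤- r≤x) (∏-nonNeg rs≤)) (sym (eval-X-*ᴾ r ∏[X- rs ] x))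

  mutual

    -- No zero exceeds the first point, so the product is nonnegative there. The remaining points
    -- lie below the next zero r or at it, where the factor X - r is at most 0; splitting it off
    -- reverses the sign and leads back to the first situation.
    ∏-alternates : ∀ {u rs ss} → Interleaved u ss rs → Alternates (eval ∏[X- rs ]) ss
    ∏-alternates []        = tt
    ∏-alternates (s≤u ∷ i) = ∏-nonNeg (proj₁ (interleaved-bound ≤.refl i)) , ∏-alternates⁻ i

    ∏-alternates⁻ : ∀ {u rs ss} → Interleaved u rs ss → Alternates (λ x → - eval ∏[X- rs ] x) ss
    ∏-alternates⁻ [] = tt
    ∏-alternates⁻ (_∷_ {r = r} {rs} _ i) = alternates-follows
      (All.map (λ {x} x≤r → 1# , r - x , 0<1 , ≤⇒0≤- x≤r , lincomb (eval-X-*ᴾ r ∏[X- rs ] x)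
        (solve 4 (λ r x s t → :1 :* (:- s) :- (r :- x) :* t := (:- :1) :* (s :- (x :- r) :* t))
          refl r x _ _)) (proj₁ (interleaved-bound ≤.refl i)))
      (∏-alternates i)

  eval-congˣ : ∀ p {x y} → x ≈ y → eval p x ≈ eval p y
  eval-congˣ []      x≈y = refl
  eval-congˣ (a ∷ p) x≈y = +-congˡ (*-cong x≈y (eval-congˣ p x≈y))

  eval-constant : ∀ {a} p x → HasLeading a 0 p → eval p x ≈ a
  eval-constant []      x (l , z) = l
  eval-constant (b ∷ p) x (l , z) = trans (+-cong l (trans
    (*-congˡ (eval-≈0 p x (λ k → z (suc k) (s≤s z≤n)))) (zeroʳ x))) (+-identityʳ _)

  -- Dividing p by X − r must leave a value ≥ 0 at s.  This is automatic for a
  -- zero r > s; if no other zero is at hand then r = s serves, unless the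
  -- quotient by X − s is negative at s, and then it has a zero r > s itself.
  zero-between : ∀ p {s u} → s < u → 0# ≤ eval p u → 0# ≤ - eval p s →
                 ∃ λ r → s ≤ r × r ≤ u × eval p r ≈ 0# × 0# ≤ eval (quot p r) s
  zero-between p {s} {u} (s≤u , s≉u) 0≤pu ps≤0 with >0-or-≈0 0≤pu
  ... | inj₂ pu≈0 = u , s≤u , ≤.refl , pu≈0 ,
    *-cancelˡ-nonNeg 0<u-s (≥0-resp (+-nonNeg ps≤0 0≤pu) (lincomb (eval-quot p u s)
      (solve 5 (λ s u ps pu q → :- ps :+ pu :- (u :- s) :* q := (:- :1) :* (ps :- pu :- (s :- u) :* q))
        refl s u _ _ _)))
    where
    0<u-s : 0# < u - s
    0<u-s = ≤⇒0≤- s≤u , λ e → s≉u (lincomb e (solve 2 (λ s u → s :- u := :1 :* (:0 :- (u :- s))) refl s u))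
  ... | inj₁ 0<pu with >0-or-≈0 ps≤0
  ...   | inj₁ ps<0 = let (r , s≤r , r≤u , pr≈0) = intermediate-value p s u s≤u 0<pu ps<0 in
    r , s≤r , r≤u , pr≈0 , proj₁ (*-cancelˡ-pos (≤⇒0≤- s≤r) (>0-resp ps<0 (lincomb₂ (eval-quot p r s) pr≈0
      (solve 5 (λ s r ps pr q → :- ps :- (r :- s) :* q
                                  := (:- :1) :* (ps :- pr :- (s :- r) :* q) :+ (:- :1) :* (pr :- :0))
        refl s r _ _ _))))
  ...   | inj₂ -ps≈0 with sign (eval (quot p s) s)
  ...     | inj₁ 0≤h = s , ≤.refl , s≤u ,
    lincomb -ps≈0 (solve 1 (λ ps → ps :- :0 := (:- :1) :* (:- ps :- :0)) refl _) , 0≤h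
  ...     | inj₂ h<0 = let (r , s≤r , r≤u , hr≈0) = intermediate-value (quot p s) s u s≤u 0<hu h<0 in
    r , s≤r , r≤u , pr≈0 r hr≈0 , ≤.reflexive (sym (x*y≈0⇒y≈0 (s-r≉0 r hr≈0)
      (lincomb₂ (eval-quot p r s) (trans (+-cong -ps≈0 (pr≈0 r hr≈0)) (+-identityʳ _))
        (solve 5 (λ s r ps pr q → (s :- r) :* q :- :0
            := (:- :1) :* (ps :- pr :- (s :- r) :* q) :+ (:- :1) :* (:- ps :+ pr :- :0)) refl s r _ _ _))))
    where
    0<hu : 0# < eval (quot p s) u
    0<hu = *-cancelˡ-pos (≤⇒0≤- s≤u) (>0-resp 0<pu (lincomb₂ (eval-quot p s u) -ps≈0
      (solve 5 (λ s u ps pu q → pu :- (u :- s) :* q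
                                  := :1 :* (pu :- ps :- (u :- s) :* q) :+ (:- :1) :* (:- ps :- :0))
        refl s u _ _ _)))
    pr≈0 : ∀ r → eval (quot p s) r ≈ 0# → eval p r ≈ 0#
    pr≈0 r hr≈0 = lincomb₂ (trans (eval-quot p s r) (trans (*-congˡ hr≈0) (zeroʳ _))) -ps≈0
      (solve 2 (λ pr ps → pr :- :0 := :1 :* (pr :- ps :- :0) :+ (:- :1) :* (:- ps :- :0)) refl _ _)
    s-r≉0 : ∀ r → eval (quot p s) r ≈ 0# → ¬ s - r ≈ 0#
    s-r≉0 r hr≈0 s-r≈0 = proj₂ h<0 (trans (sym -0#≈0#) (-‿cong (trans (sym hr≈0)
      (eval-congˣ (quot p s) (lincomb s-r≈0 (solve 2 (λ s r → r :- s := (:- :1) :* (s :- r :- :0)) refl s r))))))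

  factor-zero : ∀ {a rs} p r → eval p r ≈ 0# → quot p r ≈ᴾ a ·ᴾ ∏[X- rs ] → p ≈ᴾ a ·ᴾ ∏[X- r ∷ rs ]
  factor-zero {a} {rs} p r pr≈0 e k = trans (quot-correct p r pr≈0 k)
    (trans (X-*ᴾ-cong r {quot p r} {a ·ᴾ ∏[X- rs ]} e k) (X-*ᴾ-·ᴾ r a ∏[X- rs ] k))

  constant-factor : ∀ {a} p → HasLeading a 0 p → p ≈ᴾ a ·ᴾ ∏[X- [] ]
  constant-factor p (l , z) zero    = trans l (sym (*-identityʳ _))
  constant-factor p (l , z) (suc k) = z (suc k) (s≤s z≤n)

  -- A zero r in [s, u] is split off. Below s the factor X - r is negative, so the quotient has the
  -- opposite signs on ss, which is the alternation required for the list s ∷ ss; its sign at s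
  -- itself is what `zero-between` secures. Then s takes the place of u. For the larger of the two
  -- degrees a linear polynomial of slope a > 0 is left over, and its zero lies at or below the last
  -- point.
  interlacing-zeros : ∀ {a} → 0# < a → ∀ ss {e} p {u} → e ≡ length ss ⊎ e ≡ suc (length ss) →
                      HasLeading a e p → Decreasing (u ∷ ss) → Alternates (eval p) (u ∷ ss) →
                      ∃ λ rs → length rs ≡ e × p ≈ᴾ a ·ᴾ ∏[X- rs ] × Interleaved u rs ss
  interlacing-zeros {a} 0<a [] p (inj₁ ≡.refl) lead _ _ = [] , ≡.refl , constant-factor p lead , []
  interlacing-zeros {a} 0<a [] p {u} (inj₂ ≡.refl) lead _ (0≤pu , _) =
    r ∷ [] , ≡.refl ,
    factor-zero {rs = []} p r pr≈0 (constant-factor (quot p r) (quot-leading 0 p r lead)) , r≤u ∷ []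
    where
    slope : ∀ r x → eval (quot p r) x ≈ a
    slope r x = eval-constant (quot p r) x (quot-leading 0 p r lead)
    r : Carrier
    r = a ⁻¹ * - eval p 0#
    ar≈ : a * r ≈ - eval p 0#
    ar≈ = trans (sym (*-assoc _ _ _)) (trans (*-congʳ (⁻¹-inverseʳ a (≉0 0<a))) (*-identityˡ _))
    pr≈0 : eval p r ≈ 0#
    pr≈0 = lincomb₂ (trans (eval-quot p 0# r) (*-congˡ (slope 0# r))) ar≈
      (solve 4 (λ a r pr p0 → pr :- :0 := :1 :* (pr :- p0 :- (r :- :0) :* a) :+ :1 :* (a :* r :- (:- p0)))
        refl a r _ _)
    r≤u : r ≤ u
    r≤u = 0≤-⇒≤ (*-cancelˡ-nonNeg 0<a (≥0-resp 0≤pu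
      (lincomb₂ (trans (eval-quot p r u) (*-congˡ (slope r u))) pr≈0
        (solve 5 (λ a r u pr pu → pu :- a :* (u :- r) := :1 :* (pu :- pr :- (u :- r) :* a) :+ :1 :* (pr :- :0))
          refl a r u _ _))))
  interlacing-zeros {a} 0<a (s ∷ ss) p {u} e lead ((s<u ∷ _) ∷ (ss<s ∷ dec)) (0≤pu , ps≤0 , alt)
    with pred-length e
    where
    pred-length : ∀ {e} → e ≡ suc (length ss) ⊎ e ≡ suc (suc (length ss)) →
                  ∃ λ d → e ≡ suc d × (d ≡ length ss ⊎ d ≡ suc (length ss))
    pred-length (inj₁ e) = _ , e , inj₁ ≡.refl
    pred-length (inj₂ e) = _ , e , inj₂ ≡.refl
  ... | d , ≡.refl , d≡ =
    let (r , s≤r , r≤u , pr≈0 , 0≤hs) = zero-between p s<u 0≤pu ps≤0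
        (rs , len , e , i) = interlacing-zeros 0<a ss (quot p r) d≡ (quot-leading d p r lead) (ss<s ∷ dec)
          (0≤hs , alternates-follows (All.map (λ {x} → follows r s≤r pr≈0 x) ss<s) alt)
    in r ∷ rs , ≡.cong suc len , factor-zero {rs = rs} p r pr≈0 e , r≤u ∷ s≤r ∷ i
    where
    follows : ∀ r → s ≤ r → eval p r ≈ 0# → ∀ x → x < s →
              Follows (λ x → - - eval p x) (λ x → - eval (quot p r) x) x
    follows r s≤r pr≈0 x (x≤s , x≉s) = r - x , 1# , 0<r-x , proj₁ 0<1 ,
      lincomb₂ (eval-quot p r x) pr≈0
        (solve 5 (λ r x px pr q → (r :- x) :* (:- q) :- :1 :* (:- (:- px))
                                    := (:- :1) :* (px :- pr :- (x :- r) :* q) :+ (:- :1) :* (pr :- :0))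
          refl r x _ _ _)
      where
      0<r-x : 0# < r - x
      0<r-x = ≤⇒0≤- (≤.trans x≤s s≤r) , λ e → x≉s (≤.antisym x≤s (≤.trans s≤r (≤.reflexive
        (lincomb e (solve 2 (λ r x → r :- x := (:- :1) :* (:0 :- (r :- x))) refl r x)))))

-- Binomial recurrences for B and U, and the coefficients of F.

module Recurrences {c ℓ₁ ℓ₂} (ℝ : RealField c ℓ₁ ℓ₂) where

  open RealField ℝ
  open Interlacing ℝ
  open Narayana ℝ
  open OrderedField ℝ
  open Evaluation ℝ
  open import Algebra.Properties.Monoid.Mult +-monoid using (×-homo-+)

  fromℕ-nonNeg : ∀ n → 0# ≤ fromℕ n
  fromℕ-nonNeg zero    = ≤.refl
  fromℕ-nonNeg (suc n) = +-nonNeg (proj₁ 0<1) (fromℕ-nonNeg n)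

  fromℕ-pos : ∀ n → 0# < fromℕ (suc n)
  fromℕ-pos n = +-pos-nonNeg 0<1 (fromℕ-nonNeg n)

  binom : ℕ → ℕ → Carrier
  binom n k = fromℕ (n C k)

  binom-pascal : ∀ n k → binom (suc n) (suc k) ≈ binom n k + binom n (suc k)
  binom-pascal n k = trans (reflexive (≡.cong fromℕ (≡.sym (nCk+nC[k+1]≡[n+1]C[k+1] n k))))
    (×-homo-+ 1# (n C k) (n C suc k))

  binom-zero : ∀ n → binom n 0 ≈ 1#
  binom-zero n = +-identityʳ 1#

  binom-one : ∀ n → binom n 1 ≈ fromℕ n
  binom-one n = reflexive (≡.cong fromℕ (nC1≡n n))

  binom-diag : ∀ n → binom n n ≈ 1#
  binom-diag n = trans (reflexive (≡.cong fromℕ (nCn≡1 n))) (+-identityʳ 1#)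

  binom-> : ∀ {n k} → n <ℕ k → binom n k ≈ 0#
  binom-> n<k = reflexive (≡.cong fromℕ (k>n⇒nCk≡0 n<k))

  binom-pred : ∀ n → binom (suc n) n ≈ fromℕ (suc n)
  binom-pred zero    = refl
  binom-pred (suc n) = trans (binom-pascal (suc n) n)
    (trans (+-cong (binom-pred n) (binom-diag (suc n))) (+-comm _ _))

  binom-absorb : ∀ n k → fromℕ (suc k) * binom (suc n) (suc k) ≈ fromℕ (suc n) * binom n k
  binom-absorb zero    zero    = refl
  binom-absorb zero    (suc k) = trans (trans (*-congˡ (binom-> {1} {suc (suc k)} (s≤s (s≤s z≤n)))) (zeroʳ _))
    (sym (trans (*-congˡ (binom-> {0} {suc k} (s≤s z≤n))) (zeroʳ _)))
  binom-absorb (suc n) zero    = lincomb₂ (binom-one (suc (suc n))) (binom-zero (suc n))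
    (solve 3 (λ n b d → (:1 :+ :0) :* b :- (:1 :+ n) :* d
        := :1 :* (b :- (:1 :+ n)) :+ (:- (:1 :+ n)) :* (d :- :1)) refl (fromℕ (suc n)) (binom (suc (suc n)) 1) (binom (suc n) 0))
  binom-absorb (suc n) (suc k) = lincomb₂ {k = fromℕ (suc (suc k))} (binom-pascal (suc n) (suc k)) (binom-absorb n (suc k))
    (lincomb₂ (binom-absorb n k) (binom-pascal n k)
      (solve 7 (λ n κ p q r a b →
          (:1 :+ (:1 :+ κ)) :* p :- (:1 :+ (:1 :+ n)) :* q
            :- ((:1 :+ (:1 :+ κ)) :* (p :- (q :+ r)) :+ :1 :* ((:1 :+ (:1 :+ κ)) :* r :- (:1 :+ n) :* b))
          := :1 :* ((:1 :+ κ) :* q :- (:1 :+ n) :* a) :+ (:- (:1 :+ n)) :* (q :- (a :+ b)))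
        refl (fromℕ n) (fromℕ k) (binom (suc (suc n)) (suc (suc k))) (binom (suc n) (suc k))
        (binom (suc n) (suc (suc k))) (binom n k) (binom n (suc k))))

  -- Since f vanishes from n on, the formula holds at every index, and the coefficient identities
  -- below are free of range conditions.
  coeff-applyUpTo : ∀ f n → (∀ k → n ≤ℕ k → f k ≈ 0#) → ∀ k → coeff (applyUpTo f n) k ≈ f k
  coeff-applyUpTo f zero    f≈0 k       = sym (f≈0 k z≤n)
  coeff-applyUpTo f (suc n) f≈0 zero    = refl
  coeff-applyUpTo f (suc n) f≈0 (suc k) =
    coeff-applyUpTo (λ k → f (suc k)) n (λ k n≤k → f≈0 (suc k) (s≤s n≤k)) k

  coeff-N-B : ∀ n k → coeff (N-B n) k ≈ binom n k * binom n k
  coeff-N-B n = coeff-applyUpTo (λ k → binom n k * binom n k) (suc n)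
    (λ k n<k → trans (*-congʳ (binom-> n<k)) (zeroˡ _))

  -- n N-A (n − 1)
  N-A′ : ℕ → Poly
  N-A′ n = applyUpTo (λ k → binom n k * binom n (suc k)) n

  coeff-N-A′ : ∀ n k → coeff (N-A′ n) k ≈ binom n k * binom n (suc k)
  coeff-N-A′ n = coeff-applyUpTo (λ k → binom n k * binom n (suc k)) n
    (λ k n≤k → trans (*-congˡ (binom-> (s≤s n≤k))) (zeroʳ _))

  -- Pascal's rule squared: the cross terms 2 a b are twice the coefficients of `N-A′ n`, shifted by
  -- one.
  N-B-suc : ∀ n → N-B (suc n) ≈ᴾ (N-B n +ᴾ X· N-B n) +ᴾ 2# ·ᴾ X· N-A′ n
  N-B-suc n zero = trans (coeff-N-B (suc n) 0) (trans
    (trans (*-cong (binom-zero (suc n)) (binom-zero (suc n))) (trans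
      (solve 0 (:1 :* :1 := :1 :* :1 :+ :0 :+ :2 :* :0) refl)
      (sym (+-congʳ (+-congʳ (*-cong (binom-zero n) (binom-zero n)))))))
    (sym (trans (coeff-+ᴾ (N-B n +ᴾ X· N-B n) (2# ·ᴾ X· N-A′ n) 0)
      (+-congʳ (trans (coeff-+ᴾ (N-B n) (X· N-B n) 0) (+-congʳ (coeff-N-B n 0)))))))
  N-B-suc n (suc k) = trans (trans (coeff-N-B (suc n) (suc k)) (*-cong (binom-pascal n k) (binom-pascal n k)))
    (trans (solve 2 (λ a b → (a :+ b) :* (a :+ b) := b :* b :+ a :* a :+ :2 :* (a :* b)) refl _ _)
    (sym (trans (coeff-+ᴾ (N-B n +ᴾ X· N-B n) (2# ·ᴾ X· N-A′ n) (suc k))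
      (+-cong (trans (coeff-+ᴾ (N-B n) (X· N-B n) (suc k)) (+-cong (coeff-N-B n (suc k)) (coeff-N-B n k)))
              (trans (coeff-·ᴾ 2# (X· N-A′ n) (suc k)) (*-congˡ (coeff-N-A′ n k)))))))

  N-A′-suc : ∀ n → fromℕ (suc (suc n)) ·ᴾ N-A′ (suc n) ≈ᴾ
                   fromℕ (suc n) ·ᴾ ((N-A′ n +ᴾ X· N-A′ n) +ᴾ 2# ·ᴾ N-B n)
  N-A′-suc n k = trans (trans (coeff-·ᴾ _ (N-A′ (suc n)) k) (*-congˡ (coeff-N-A′ (suc n) k)))
    (trans (core k) (sym (trans (coeff-·ᴾ _ ((N-A′ n +ᴾ X· N-A′ n) +ᴾ 2# ·ᴾ N-B n) k) (*-congˡ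
      (trans (coeff-+ᴾ (N-A′ n +ᴾ X· N-A′ n) (2# ·ᴾ N-B n) k)
        (+-cong (trans (coeff-+ᴾ (N-A′ n) (X· N-A′ n) k) (+-cong (coeff-N-A′ n k) (shifted k)))
                (trans (coeff-·ᴾ 2# (N-B n) k) (*-congˡ (coeff-N-B n k)))))))))
    where
    pred-term : ℕ → Carrier
    pred-term zero    = 0#
    pred-term (suc k) = binom n k * binom n (suc k)
    shifted : ∀ k → coeff (X· N-A′ n) k ≈ pred-term k
    shifted zero    = refl
    shifted (suc k) = coeff-N-A′ n k
    core : ∀ k → fromℕ (suc (suc n)) * (binom (suc n) k * binom (suc n) (suc k)) ≈
                 fromℕ (suc n) * (binom n k * binom n (suc k) + pred-term k + 2# * (binom n k * binom n k))
    core zero = trans (*-congˡ (*-cong (binom-zero (suc n)) (binom-one (suc n)))) (trans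
      (solve 1 (λ n → (:1 :+ (:1 :+ n)) :* (:1 :* (:1 :+ n))
                       := (:1 :+ n) :* (:1 :* n :+ :0 :+ :2 :* (:1 :* :1))) refl (fromℕ n))
      (sym (*-congˡ (+-cong (+-congʳ (*-cong (binom-zero n) (binom-one n)))
                            (*-congˡ (*-cong (binom-zero n) (binom-zero n)))))))
    -- Eliminating k from the two absorption rules (k + 1)(a + b) = (n + 1) a and (k + 2)(b + d) =
    -- (n + 1) b gives (a + b)(b + d) = (n + 1)(b² - a d), which is the claim after expansion.
    core (suc k) = trans (*-congˡ (*-cong (binom-pascal n k) (binom-pascal n (suc k))))
      (lincomb₂ (trans (*-congˡ (sym (binom-pascal n k))) (binom-absorb n k))
                (trans (*-congˡ (sym (binom-pascal n (suc k)))) (binom-absorb n (suc k)))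
        (solve 5 (λ n κ a b d →
            (:1 :+ (:1 :+ n)) :* ((a :+ b) :* (b :+ d))
              :- (:1 :+ n) :* (b :* d :+ a :* b :+ :2 :* (b :* b))
            := (:- (b :+ d)) :* ((:1 :+ κ) :* (a :+ b) :- (:1 :+ n) :* a)
               :+ (a :+ b) :* ((:1 :+ (:1 :+ κ)) :* (b :+ d) :- (:1 :+ n) :* b))
          refl (fromℕ n) (fromℕ k) (binom n k) (binom n (suc k)) (binom n (suc (suc k)))))

  -- With t = (1 + x)/(1 - x) and Legendre polynomials Pₙ, these are (1 - x)ⁿ Pₙ(t) and 2 x (1 -
  -- x)ⁿ⁻¹ Pₙ′(t). The factor n + 1 in U absorbs the ratio n + 2 : n + 1 of `N-A′-suc`, so `U-suc`
  -- has no denominators.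
  B U : ℕ → Carrier → Carrier
  B n x = eval (N-B n) x
  U n x = fromℕ (suc n) * (x * eval (N-A′ n) x)

  B-zero : ∀ x → B 0 x ≈ 1#
  B-zero x = solve 1 (λ x → (:1 :+ :0) :* (:1 :+ :0) :+ x :* :0 := :1) refl x

  U-zero : ∀ x → U 0 x ≈ 0#
  U-zero x = solve 1 (λ x → (:1 :+ :0) :* (x :* :0) := :0) refl x

  B-suc : ∀ n x → fromℕ (suc n) * B (suc n) x ≈ fromℕ (suc n) * ((1# + x) * B n x) + 2# * U n x
  B-suc n x = trans (*-congˡ (trans (eval-cong (N-B (suc n)) ((N-B n +ᴾ X· N-B n) +ᴾ 2# ·ᴾ X· N-A′ n) x (N-B-suc n))
      (trans (eval-+ᴾ (N-B n +ᴾ X· N-B n) (2# ·ᴾ X· N-A′ n) x)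
        (+-cong (eval-+ᴾ (N-B n) (X· N-B n) x) (eval-·ᴾ 2# (X· N-A′ n) x)))))
    (solve 4 (λ n x b a → n :* (b :+ (:0 :+ x :* b) :+ :2 :* (:0 :+ x :* a))
                := n :* ((:1 :+ x) :* b) :+ :2 :* (n :* (x :* a))) refl (fromℕ (suc n)) x (B n x) (eval (N-A′ n) x))

  U-suc : ∀ n x → U (suc n) x ≈ (1# + x) * U n x + 2# * (fromℕ (suc n) * (x * B n x))
  U-suc n x = lincomb (trans (sym (eval-·ᴾ (fromℕ (suc (suc n))) (N-A′ (suc n)) x))
      (trans (eval-cong (fromℕ (suc (suc n)) ·ᴾ N-A′ (suc n)) (fromℕ (suc n) ·ᴾ ((N-A′ n +ᴾ X· N-A′ n) +ᴾ 2# ·ᴾ N-B n)) x (N-A′-suc n))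
        (trans (eval-·ᴾ (fromℕ (suc n)) ((N-A′ n +ᴾ X· N-A′ n) +ᴾ 2# ·ᴾ N-B n) x) (*-congˡ
          (trans (eval-+ᴾ (N-A′ n +ᴾ X· N-A′ n) (2# ·ᴾ N-B n) x)
            (+-cong (eval-+ᴾ (N-A′ n) (X· N-A′ n) x) (eval-·ᴾ 2# (N-B n) x)))))))
    (solve 6 (λ n n′ x b a a′ →
        n′ :* (x :* a′) :- ((:1 :+ x) :* (n :* (x :* a)) :+ :2 :* (n :* (x :* b)))
          := x :* (n′ :* a′ :- n :* (a :+ (:0 :+ x :* a) :+ :2 :* b)))
      refl (fromℕ (suc n)) (fromℕ (suc (suc n))) x (B n x) (eval (N-A′ n) x) (eval (N-A′ (suc n)) x))

  F-eval : ∀ α β n x → let m = fromℕ (suc n) in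
           m * eval (F α β (suc (suc n))) x ≈ m * (α * B (suc (suc n)) x) + β * U (suc n) x
  F-eval α β n x = trans (*-congˡ (trans (eval-+ᴾ (α ·ᴾ N-B (suc (suc n))) ((β * fromℕ (suc (suc n))) ·ᴾ X· N-A n) x)
      (+-cong (eval-·ᴾ α (N-B (suc (suc n))) x) (trans (eval-·ᴾ (β * fromℕ (suc (suc n))) (X· N-A n) x)
        (*-congˡ (+-congˡ (*-congˡ (eval-·ᴾ (m ⁻¹) (N-A′ (suc n)) x))))))))
    (lincomb (⁻¹-inverseʳ m (≉0 (fromℕ-pos n)))
      (solve 8 (λ α β m i m′ x b a →
          m :* (α :* b :+ (β :* m′) :* (:0 :+ x :* (i :* a))) :- (m :* (α :* b) :+ β :* (m′ :* (x :* a)))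
            := (β :* (m′ :* (x :* a))) :* (m :* i :- :1))
        refl α β m (m ⁻¹) (fromℕ (suc (suc n))) x (B (suc (suc n)) x) (eval (N-A′ (suc n)) x)))
    where m = fromℕ (suc n)

  coeff-F : ∀ α β n k → coeff (F α β (suc (suc n))) (suc k) ≈
            α * (binom (suc (suc n)) (suc k) * binom (suc (suc n)) (suc k)) +
            (β * fromℕ (suc (suc n))) * (fromℕ (suc n) ⁻¹ * (binom (suc n) k * binom (suc n) (suc k)))
  coeff-F α β n k = trans (coeff-+ᴾ (α ·ᴾ N-B (suc (suc n))) ((β * fromℕ (suc (suc n))) ·ᴾ X· N-A n) (suc k))
    (+-cong (trans (coeff-·ᴾ α (N-B (suc (suc n))) (suc k)) (*-congˡ (coeff-N-B (suc (suc n)) (suc k))))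
            (trans (coeff-·ᴾ (β * fromℕ (suc (suc n))) (X· N-A n) (suc k)) (*-congˡ
              (trans (coeff-·ᴾ (fromℕ (suc n) ⁻¹) (N-A′ (suc n)) k) (*-congˡ (coeff-N-A′ (suc n) k))))))

  N-B-leading : ∀ n → HasLeading 1# n (N-B n)
  N-B-leading n =
      trans (coeff-N-B n n) (trans (*-cong (binom-diag n) (binom-diag n)) (*-identityˡ 1#))
    , λ k n<k → trans (coeff-N-B n k) (trans (*-congʳ (binom-> n<k)) (zeroˡ _))

  coeff-F-top : ∀ α β n k → n <ℕ k → coeff (F α β (suc (suc n))) (suc k) ≈
                α * (binom (suc (suc n)) (suc k) * binom (suc (suc n)) (suc k))
  coeff-F-top α β n k n<k = trans (coeff-F α β n k)
    (trans (+-congˡ (*-congˡ (*-congˡ (*-congˡ (binom-> {suc n} {suc k} (s≤s n<k))))))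
      (solve 4 (λ t m i a → t :+ m :* (i :* (a :* :0)) := t) refl _ _ _ _))

  F-leading : ∀ α β n → HasLeading α (suc (suc n)) (F α β (suc (suc n)))
  F-leading α β n =
      trans (coeff-F-top α β n (suc n) ℕ.≤-refl)
        (trans (*-congˡ (*-cong (binom-diag (suc (suc n))) (binom-diag (suc (suc n)))))
          (solve 1 (λ α → α :* (:1 :* :1) := α) refl α))
    , λ { (suc k) (s≤s n<k) → trans (coeff-F-top α β n k (ℕ.<⇒≤ n<k))
          (trans (*-congˡ (*-congˡ (binom-> (s≤s n<k)))) (solve 2 (λ α b → α :* (b :* :0) := :0) refl α _)) }

  -- For α = 0 the degree drops by one. The top term is then that of x `N-A n`, and `N-A n` is
  -- monic.
  F-leading-0 : ∀ {α} β n → α ≈ 0# →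
                HasLeading (β * fromℕ (suc (suc n))) (suc n) (F α β (suc (suc n)))
  F-leading-0 {α} β n α≈0 =
      trans (coeff-F α β n n) (trans
        (+-cong (*-congʳ α≈0) (*-congˡ (*-congˡ (*-cong (binom-pred n) (binom-diag (suc n))))))
        (lincomb (⁻¹-inverseʳ m (≉0 (fromℕ-pos n)))
          (solve 5 (λ β m′ m i t → :0 :* t :+ β :* m′ :* (i :* (m :* :1)) :- β :* m′
                                     := (β :* m′) :* (m :* i :- :1))
            refl β (fromℕ (suc (suc n))) m (m ⁻¹) _)))
    , λ { (suc k) (s≤s n<k) → trans (coeff-F-top α β n k n<k) (trans (*-congʳ α≈0) (zeroˡ _)) }
    where m = fromℕ (suc n)

-- The zeros of B, and an estimate of U by B.

module Zeros {c ℓ₁ ℓ₂} (ℝ : RealField c ℓ₁ ℓ₂) where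

  open RealField ℝ
  open Interlacing ℝ
  open Narayana ℝ
  open OrderedField ℝ
  open Evaluation ℝ
  open SignChanges ℝ
  open Recurrences ℝ
  open import Algebra.Properties.Semiring.Exp semiring using (_^_)

  -- The recurrence can be run backwards for x ≤ 0, because its determinant is m ((1 + x)² - 4 x) =
  -- m (1 - x)² > 0; a common zero would descend to n = 0, where B = 1.
  BU-coprime : ∀ n {x} → x ≤ 0# → B n x ≈ 0# → U n x ≈ 0# → ⊥
  BU-coprime zero    {x} x≤0 b≈0 u≈0 = 0≉1 (trans (sym b≈0) (B-zero x))
  BU-coprime (suc n) {x} x≤0 b′≈0 u′≈0 = BU-coprime n x≤0 b≈0 u≈0
    where
    m = fromℕ (suc n)
    0<1-x : 0# < 1# - x
    0<1-x = >0-resp (+-pos-nonNeg 0<1 (≤⇒0≤- x≤0)) (solve 1 (λ x → :1 :+ (:0 :- x) := :1 :- x) refl x)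
    B≈ : m * ((1# + x) * B n x) + 2# * U n x ≈ 0#
    B≈ = trans (sym (B-suc n x)) (trans (*-congˡ b′≈0) (zeroʳ m))
    b≈0 : B n x ≈ 0#
    b≈0 = x*y≈0⇒y≈0 (≉0 (*-pos (fromℕ-pos n) (*-pos 0<1-x 0<1-x)))
      (lincomb₂ B≈ (trans (sym (U-suc n x)) u′≈0)
        (solve 4 (λ m x b u → m :* ((:1 :- x) :* (:1 :- x)) :* b :- :0
            := (:1 :+ x) :* (m :* ((:1 :+ x) :* b) :+ :2 :* u :- :0)
               :+ (:- :2) :* ((:1 :+ x) :* u :+ :2 :* (m :* (x :* b)) :- :0))
          refl m x (B n x) (U n x)))
    u≈0 : U n x ≈ 0#
    u≈0 = x*y≈0⇒y≈0 (≉0 0<2) (lincomb₂ B≈ b≈0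
      (solve 4 (λ m x b u → :2 :* u :- :0
          := :1 :* (m :* ((:1 :+ x) :* b) :+ :2 :* u :- :0) :+ (:- (m :* (:1 :+ x))) :* (b :- :0))
        refl m x (B n x) (U n x)))

  BU-pos : ∀ n {x} → 0# ≤ x → 0# < B n x × 0# ≤ U n x
  BU-pos zero    {x} 0≤x = >0-resp 0<1 (sym (B-zero x)) , ≥0-resp ≤.refl (sym (U-zero x))
  BU-pos (suc n) {x} 0≤x with BU-pos n 0≤x
  ... | 0<b , 0≤u =
      *-cancelˡ-pos (fromℕ-nonNeg (suc n)) (>0-resp
        (+-pos-nonNeg (*-pos (fromℕ-pos n) (*-pos (+-pos-nonNeg 0<1 0≤x) 0<b))
                      (*-nonNegative (proj₁ 0<2) 0≤u))
        (sym (B-suc n x)))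
    , ≥0-resp (+-nonNeg (*-nonNegative (+-nonNeg (proj₁ 0<1) 0≤x) 0≤u)
                        (*-nonNegative (proj₁ 0<2) (*-nonNegative (fromℕ-nonNeg (suc n))
                          (*-nonNegative 0≤x (proj₁ 0<b)))))
        (sym (U-suc n x))

  U-pos : ∀ n {x} → 0# < x → 0# < U (suc n) x
  U-pos n {x} 0<x = >0-resp
    (+-pos-nonNeg (*-pos 0<2 (*-pos (fromℕ-pos n) (*-pos 0<x (proj₁ (BU-pos n (proj₁ 0<x))))))
      (*-nonNegative (+-nonNeg (proj₁ 0<1) (proj₁ 0<x)) (proj₂ (BU-pos n (proj₁ 0<x)))))
    (sym (trans (U-suc n x) (+-comm _ _)))

  ≯0⇒≤0 : ∀ {x} → ¬ 0# < x → x ≤ 0#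
  ≯0⇒≤0 {x} x≯0 with sign (- x)
  ... | inj₁ 0≤-x  = 0≤-⇒≤ (≥0-resp 0≤-x (sym (+-identityˡ _)))
  ... | inj₂ 0<--x = ⊥-elim (x≯0 (>0-resp 0<--x (solve 1 (λ x → :- (:- x) := x) refl x)))

  ≤0⇒<1 : ∀ {x} → x ≤ 0# → x < 1#
  ≤0⇒<1 x≤0 = ≤.trans x≤0 (proj₁ 0<1) , λ x≈1 →
    0≉1 (≤.antisym (proj₁ 0<1) (≤.trans (≤.reflexive (sym x≈1)) x≤0))

  ∏-zeros : ∀ rs → All (λ r → eval ∏[X- rs ] r ≈ 0#) rs
  ∏-zeros []       = []
  ∏-zeros (r ∷ rs) =
      trans (eval-X-*ᴾ r ∏[X- rs ] r) (trans (*-congʳ (-‿inverseʳ r)) (zeroˡ _))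
    ∷ All.map (λ {x} e → trans (eval-X-*ᴾ r ∏[X- rs ] x) (trans (*-congˡ e) (zeroʳ _))) (∏-zeros rs)

  factored-zeros : ∀ p a {rs} → p ≈ᴾ a ·ᴾ ∏[X- rs ] → All (λ r → eval p r ≈ 0#) rs
  factored-zeros p a {rs} p≈ =
    All.map (λ {x} e → trans (eval-factor {p} {a} {rs} x p≈) (trans (*-congˡ e) (zeroʳ a))) (∏-zeros rs)

  -- The induction hypothesis on n. The entry 1 in front of the zeros serves as upper end of the
  -- sample points; U starts with the sign ≤ 0 at the largest zero.
  record ZerosOfB (n : ℕ) : Set (c ⊔ ℓ₁ ⊔ ℓ₂) where
    field
      zeros        : List Carrier
      count        : length zeros ≡ n
      factored     : N-B n ≈ᴾ 1# ·ᴾ ∏[X- zeros ]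
      decreasing   : Decreasing (1# ∷ zeros)
      nonPositive  : All (_≤ 0#) zeros
      U-alternates : Alternates (λ x → - U n x) zeros

    vanishes : All (λ r → B n r ≈ 0#) zeros
    vanishes = factored-zeros (N-B n) 1# factored

    B-factored : ∀ x → B n x ≈ eval ∏[X- zeros ] x
    B-factored x = trans (eval-factor {N-B n} {1#} {zeros} x factored) (*-identityˡ _)

    U-nonZero : All (λ r → ¬ U n r ≈ 0#) zeros
    U-nonZero = All.zipWith (λ (r≤0 , b≈0) u≈0 → BU-coprime n r≤0 b≈0 u≈0) (nonPositive , vanishes)

  -- At a zero of B the recurrence reads m B⁺ = 2 U, so the signs of U locate the zeros of B⁺. As U
  -- does not vanish there, B and B⁺ share no zero, which makes the new zeros distinct.
  zerosOfB : ∀ n → ZerosOfB n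
  zerosOfB zero = record
    { zeros = [] ; count = ≡.refl ; decreasing = [] ∷ [] ; nonPositive = [] ; U-alternates = tt
    ; factored = constant-factor (N-B 0) (N-B-leading 0) }
  zerosOfB (suc n) = record
    { zeros        = ss
    ; count        = proj₁ (proj₂ found)
    ; factored     = factored′
    ; decreasing   = All.map ≤0⇒<1 nonPositive′ ∷ interleaved-decreasing
        (λ x → B (suc n) x ≈ 0#) (λ x≈y e → trans (eval-congˣ (N-B (suc n)) (sym x≈y)) e) inter vanishes′
        (All.zipWith (λ (b≈0 , u≉0) b′≈0 → u≉0 (x*y≈0⇒y≈0 (≉0 0<2)
            (trans (sym (at-zero b≈0)) (trans (*-congˡ b′≈0) (zeroʳ m))))) (vanishes , U-nonZero))
    ; nonPositive  = nonPositive′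
    -- Where B⁺(s) = 0, eliminating U gives 2 U⁺(s) = -m (1 - s)² B(s), so -U⁺ alternates as B does.
    ; U-alternates = alternates-follows
        (All.map (λ {s} b′≈0 → 2# , m * ((1# - s) * (1# - s)) , 0<2
            , *-nonNegative (fromℕ-nonNeg (suc n)) (0≤x² (1# - s)) , follows s b′≈0) vanishes′)
        (∏-alternates inter)
    }
    where
    open ZerosOfB (zerosOfB n)
    m = fromℕ (suc n)
    at-zero : ∀ {r} → B n r ≈ 0# → m * B (suc n) r ≈ 2# * U n r
    at-zero {r} b≈0 = trans (B-suc n r) (lincomb b≈0
      (solve 4 (λ m x b u → m :* ((:1 :+ x) :* b) :+ :2 :* u :- :2 :* u
                              := (m :* (:1 :+ x)) :* (b :- :0)) refl m r (B n r) (U n r)))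
    found = interlacing-zeros 0<1 zeros (N-B (suc n)) {1#} (inj₂ (≡.cong suc (≡.sym count)))
      (N-B-leading (suc n)) decreasing
      ( proj₁ (proj₁ (BU-pos (suc n) (proj₁ 0<1)))
      , alternates-follows (All.map (λ {r} b≈0 → m , 2# , fromℕ-pos n , proj₁ 0<2 , lincomb (at-zero b≈0)
            (solve 3 (λ m b u → m :* (:- b) :- :2 :* (:- u) := (:- :1) :* (m :* b :- :2 :* u))
              refl m (B (suc n) r) (U n r)))
          vanishes) U-alternates)
    ss = proj₁ found
    factored′ = proj₁ (proj₂ (proj₂ found))
    inter = proj₂ (proj₂ (proj₂ found))
    vanishes′ = factored-zeros (N-B (suc n)) 1# factored′
    nonPositive′ : All (_≤ 0#) ss
    nonPositive′ = All.map (λ b′≈0 → ≯0⇒≤0 (λ 0<s →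
      ≉0 (proj₁ (BU-pos (suc n) (proj₁ 0<s))) b′≈0)) vanishes′
    follows : ∀ s → B (suc n) s ≈ 0# →
              2# * - U (suc n) s ≈ m * ((1# - s) * (1# - s)) * eval ∏[X- zeros ] s
    follows s b′≈0 = trans
      (lincomb₂ (U-suc n s) (trans (sym (B-suc n s)) (trans (*-congˡ b′≈0) (zeroʳ m)))
        (solve 5 (λ m x b u u′ → :2 :* (:- u′) :- m :* ((:1 :- x) :* (:1 :- x)) :* b
            := (:- :2) :* (u′ :- ((:1 :+ x) :* u :+ :2 :* (m :* (x :* b))))
               :+ (:- (:1 :+ x)) :* (m :* ((:1 :+ x) :* b) :+ :2 :* u :- :0))
          refl m s (B n s) (U n s) (U (suc n) s)))
      (*-congˡ (B-factored s))

  -- In the variable t = (1 + x)/(1 − x) this is P′ₙ(t)/Pₙ(t) ≤ n(n + 1)/t for the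
  -- Legendre polynomial Pₙ when t² ≥ n(n + 1)(1 − t²); the powers of 1 + x make
  -- it symmetric under x ↦ 1/x.
  BU-estimate : ∀ n x → let z = - x ; T = 1# + x ; k = fromℕ n ; m = fromℕ (suc n) in
    x ≤ 0# → 0# < T * T → 0# ≤ T * T - 2# * (2# * (z * (k * m))) →
    0# < T ^ n * B n x × 0# ≤ T * T ^ n * U n x + 2# * (z * (k * m)) * (T ^ n * B n x)
  BU-estimate zero    x x≤0 0<τ h =
      >0-resp 0<1 (trans (sym (*-identityˡ 1#)) (*-congˡ (sym (B-zero x))))
    , ≥0-resp ≤.refl (sym (lincomb (U-zero x)
        (solve 3 (λ x u b → (:1 :+ x) :* :1 :* u :+ :2 :* (:- x :* (:0 :* (:1 :+ :0))) :* (:1 :* b) :- :0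
            := ((:1 :+ x) :* :1) :* (u :- :0)) refl x (U 0 x) (B 0 x))))
  BU-estimate (suc n) x x≤0 0<τ h =
      *-cancelˡ-pos (fromℕ-nonNeg (suc (suc n))) (>0-resp
        (+-pos-nonNeg (*-pos 0<m (*-pos 0<τ 0<b)) 0≤q)
        (solve 2 (λ a b → a :+ (b :- a) := b) refl _ _))
    -- The expression at n + 1 is τ times the one at n plus 2 z m times the difference in `0≤q`.
    , ≥0-resp (+-nonNeg (*-nonNegative (proj₁ 0<τ) 0≤g)
                        (*-nonNegative (*-nonNegative (proj₁ 0<2) (*-nonNegative 0≤z (proj₁ 0<m))) 0≤q))
        (lincomb (U-suc n x)
          (solve 7 (λ x κ t b u b′ u′ → let T = :1 :+ x ; z = :- x ; m = :1 :+ κ ; τ = T :* T in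
              τ :* (T :* t :* u :+ :2 :* (z :* (κ :* m)) :* (t :* b))
                :+ :2 :* (z :* m) :* ((:1 :+ m) :* (T :* t :* b′) :- m :* (τ :* (t :* b)))
                :- (T :* (T :* t) :* u′ :+ :2 :* (z :* (m :* (:1 :+ m))) :* (T :* t :* b′))
              := (:- (T :* (T :* t))) :* (u′ :- (T :* u :+ :2 :* (m :* (x :* b)))))
            refl x k (T ^ n) (B n x) (U n x) (B (suc n) x) (U (suc n) x)))
    where
    z = - x
    T = 1# + x
    τ = T * T
    k = fromℕ n
    m = fromℕ (suc n)
    m′ = fromℕ (suc (suc n))
    0<m = fromℕ-pos n
    0≤z : 0# ≤ z
    0≤z = ≥0-resp (≤⇒0≤- x≤0) (+-identityˡ _)
    -- The threshold 4 z n (n + 1) grows with n, here by 8 z m, so the hypothesis at n + 1 implies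
    -- the one at n.
    ih = BU-estimate n x x≤0 0<τ (≥0-resp
      (+-nonNeg h (*-nonNegative (proj₁ 0<2) (*-nonNegative (proj₁ 0<2)
        (*-nonNegative (proj₁ 0<2) (*-nonNegative 0≤z (proj₁ 0<m))))))
      (solve 3 (λ τ z κ → let m = :1 :+ κ in
          τ :- :2 :* (:2 :* (z :* (m :* (:1 :+ m)))) :+ :2 :* (:2 :* (:2 :* (z :* m)))
            := τ :- :2 :* (:2 :* (z :* (κ :* m)))) refl τ z k))
    0<b = proj₁ ih
    0≤g = proj₂ ih
    -- Let b = Tⁿ B. By the recurrence m times this difference is m τ b + 2 m′ Tⁿ⁺¹ U. The induction
    -- hypothesis Tⁿ⁺¹ U ≥ -2 z k m b leaves m b (τ - 4 z k m′), and τ ≥ 4 z m m′ ≥ 4 z k m′ by h.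
    0≤q : 0# ≤ m′ * (T ^ suc n * B (suc n) x) - m * (τ * (T ^ n * B n x))
    0≤q = *-cancelˡ-nonNeg 0<m (≥0-resp
      (+-nonNeg
        (*-nonNegative (*-nonNegative (proj₁ 0<m) (proj₁ 0<b))
          (+-nonNeg h (*-nonNegative (proj₁ 0<2) (*-nonNegative (proj₁ 0<2)
            (*-nonNegative 0≤z (fromℕ-nonNeg (suc (suc n))))))))
        (*-nonNegative (*-nonNegative (proj₁ 0<2) (fromℕ-nonNeg (suc (suc n)))) 0≤g))
      (lincomb (B-suc n x)
        (solve 6 (λ x κ t b u b′ → let T = :1 :+ x ; z = :- x ; m = :1 :+ κ ; m′ = :1 :+ m ; τ = T :* T in
            m :* (t :* b) :* (τ :- :2 :* (:2 :* (z :* (m :* m′))) :+ :2 :* (:2 :* (z :* m′)))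
              :+ :2 :* m′ :* (T :* t :* u :+ :2 :* (z :* (κ :* m)) :* (t :* b))
              :- m :* (m′ :* (T :* t :* b′) :- m :* (τ :* (t :* b)))
            := (:- (m′ :* (T :* t))) :* (m :* b′ :- (m :* (T :* b) :+ :2 :* u)))
          refl x k (T ^ n) (B n x) (U n x) (B (suc n) x))))

-- F expressed by B and U, the sign of E, and the interlacing.

module InterlacingF {c ℓ₁ ℓ₂} (ℝ : RealField c ℓ₁ ℓ₂) where

  open RealField ℝ
  open Interlacing ℝ
  open Narayana ℝ
  open OrderedField ℝ
  open Evaluation ℝ
  open SignChanges ℝ
  open Recurrences ℝ
  open Zeros ℝ
  open import Algebra.Properties.Semiring.Exp semiring using (_^_)

  module _ (α β : Carrier) where

    U-weight : ℕ → Carrier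
    U-weight n = 2# * (α * fromℕ (suc n)) + β * fromℕ (suc (suc n))

    -- This form makes g ≥ 0 visible and shows when g > 0: if α + β = 0, only the term n α is left.
    U-weight-split : ∀ n → fromℕ (suc (suc n)) * (α + β) + fromℕ n * α ≈ U-weight n
    U-weight-split n = solve 3 (λ α β k → (:1 :+ (:1 :+ k)) :* (α :+ β) :+ k :* α
      := :2 :* (α :* (:1 :+ k)) :+ β :* (:1 :+ (:1 :+ k))) refl α β (fromℕ n)

    F-BU : ∀ n x → let m = fromℕ (suc n) ; m′ = fromℕ (suc (suc n)) in
           m′ * (m * eval (F α β (suc (suc n))) x) ≈
           m * m′ * (α * ((1# + x) * B (suc n) x)) + U-weight n * U (suc n) x
    F-BU n x = lincomb₂ (F-eval α β n x) (B-suc (suc n) x)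
      (solve 9 (λ α β m m′ x b u b′ f → let T = :1 :+ x in
          m′ :* (m :* f) :- (m :* m′ :* (α :* (T :* b)) :+ (:2 :* (α :* m) :+ β :* m′) :* u)
          := m′ :* (m :* f :- (m :* (α :* b′) :+ β :* u))
             :+ (m :* α) :* (m′ :* b′ :- (m′ :* (T :* b) :+ :2 :* u)))
        refl α β (fromℕ (suc n)) (fromℕ (suc (suc n))) x (B (suc n) x) (U (suc n) x)
        (B (suc (suc n)) x) (eval (F α β (suc (suc n))) x))

    F-BU-next : ∀ n x → let m′ = fromℕ (suc (suc n)) ; m″ = fromℕ (suc (suc (suc n))) ; T = 1# + x in
      m″ * (m′ * eval (F α β (suc (suc (suc n)))) x) ≈
      m″ * (α * (T * (m′ * (T * B (suc n) x) + 2# * U (suc n) x)))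
        + U-weight (suc n) * (T * U (suc n) x + 2# * (m′ * (x * B (suc n) x)))
    F-BU-next n x = trans (F-BU (suc n) x) (lincomb₂ (B-suc (suc n) x) (U-suc (suc n) x)
      (solve 9 (λ α m′ m″ x b u b′ u′ g′ → let T = :1 :+ x in
          m′ :* m″ :* (α :* (T :* b′)) :+ g′ :* u′
            :- (m″ :* (α :* (T :* (m′ :* (T :* b) :+ :2 :* u))) :+ g′ :* (T :* u :+ :2 :* (m′ :* (x :* b))))
          := (m″ :* (α :* T)) :* (m′ :* b′ :- (m′ :* (T :* b) :+ :2 :* u))
             :+ g′ :* (u′ :- (T :* u :+ :2 :* (m′ :* (x :* b)))))
        refl α (fromℕ (suc (suc n))) (fromℕ (suc (suc (suc n)))) x (B (suc n) x) (U (suc n) x)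
        (B (suc (suc n)) x) (U (suc (suc n)) x) (U-weight (suc n))))

    -- Eliminating U from the formula for the next F yields the coefficient m″ (g - 2 m α) - m g′ of
    -- α T², with g and g′ consecutive weights; it simplifies to this.
    excess : ℕ → Carrier
    excess n = β * fromℕ (suc (suc (suc n))) - 2# * (α * (fromℕ (suc n) * fromℕ (suc (suc n))))

    E : ℕ → Carrier → Carrier
    E n x = 2# * (- x * (U-weight n * U-weight (suc n))) - α * ((1# + x) * (1# + x)) * excess n

    BU-relation : ∀ n x → eval (F α β (suc (suc n))) x ≈ 0# →
      fromℕ (suc n) * fromℕ (suc (suc n)) * (α * ((1# + x) * B (suc n) x)) + U-weight n * U (suc n) x ≈ 0#
    BU-relation n x f≈0 = trans (sym (F-BU n x)) (trans (*-congˡ (trans (*-congˡ f≈0) (zeroʳ _))) (zeroʳ _))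

    F-next-at-zero : ∀ n x → eval (F α β (suc (suc n))) x ≈ 0# →
      U-weight n * (fromℕ (suc (suc (suc n))) * (fromℕ (suc (suc n)) * eval (F α β (suc (suc (suc n)))) x))
        ≈ - (fromℕ (suc (suc n)) * E n x * B (suc n) x)
    F-next-at-zero n x f≈0 = lincomb₂ (BU-relation n x f≈0) (F-BU-next n x)
      (solve 7 (λ α β k x b u L →
          let T = :1 :+ x ; m = :1 :+ k ; m′ = :1 :+ m ; m″ = :1 :+ m′
              g = :2 :* (α :* m) :+ β :* m′ ; g′ = :2 :* (α :* m′) :+ β :* m″
              e = :2 :* (:- x :* (g :* g′)) :- α :* (T :* T) :* (β :* m″ :- :2 :* (α :* (m :* m′))) in
          g :* L :- :- (m′ :* e :* b)
          := (:2 :* (m″ :* (α :* T)) :+ g′ :* T) :* (m :* m′ :* (α :* (T :* b)) :+ g :* u :- :0)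
             :+ g :* (L :- (m″ :* (α :* (T :* (m′ :* (T :* b) :+ :2 :* u))) :+ g′ :* (T :* u :+ :2 :* (m′ :* (x :* b))))))
        refl α β (fromℕ n) x (B (suc n) x) (U (suc n) x)
        (fromℕ (suc (suc (suc n))) * (fromℕ (suc (suc n)) * eval (F α β (suc (suc (suc n)))) x)))

    module _ (0≤α : 0# ≤ α) (0≤α+β : 0# ≤ α + β) where

      U-weight-nonNeg : ∀ n → 0# ≤ U-weight n
      U-weight-nonNeg n = ≥0-resp
        (+-nonNeg (*-nonNegative (fromℕ-nonNeg (suc (suc n))) 0≤α+β) (*-nonNegative (fromℕ-nonNeg n) 0≤α))
        (U-weight-split n)

      -- If E(x) < 0 then (1 + x)² is so large compared with −x that the estimate
      -- of U by B excludes a zero of F at x.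
      E-nonNeg : ∀ n x → x ≤ 0# → eval (F α β (suc (suc n))) x ≈ 0# → 0# ≤ E n x
      E-nonNeg n x x≤0 f≈0 with sign (E n x)
      ... | inj₁ 0≤E = 0≤E
      ... | inj₂ E<0 = ⊥-elim (≉0 0<sum (lincomb (BU-relation n x f≈0)
          (solve 8 (λ α g m m′ x t b u → let T = :1 :+ x ; z = :- x in
              m :* m′ :* (t :* b) :* (α :* (T :* T) :- :2 :* (z :* g))
                :+ g :* (T :* t :* u :+ :2 :* (z :* (m :* m′)) :* (t :* b)) :- :0
              := (T :* t) :* (m :* m′ :* (α :* (T :* b)) :+ g :* u :- :0))
            refl α g m m′ x (T ^ suc n) (B (suc n) x) (U (suc n) x))))
        where
        z = - x
        T = 1# + x
        τ = T * T
        m = fromℕ (suc n)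
        m′ = fromℕ (suc (suc n))
        m″ = fromℕ (suc (suc (suc n)))
        g = U-weight n
        g′ = U-weight (suc n)
        η = excess n
        0≤z : 0# ≤ z
        0≤z = ≥0-resp (≤⇒0≤- x≤0) (+-identityˡ _)
        0<ατη : 0# < α * τ * η
        0<ατη = >0-resp (+-pos-nonNeg E<0 (*-nonNegative (proj₁ 0<2)
            (*-nonNegative 0≤z (*-nonNegative (U-weight-nonNeg n) (U-weight-nonNeg (suc n))))))
          (solve 2 (λ a b → :- (b :- a) :+ b := a) refl _ _)
        0<η : 0# < η
        0<η = *-cancelˡ-pos (*-nonNegative 0≤α (0≤x² T)) 0<ατη
        0<τ : 0# < τ
        0<τ = *-cancelˡ-pos (*-nonNegative 0≤α (proj₁ 0<η))
          (>0-resp 0<ατη (solve 3 (λ a t e → a :* t :* e := a :* e :* t) refl α τ η))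
        -- From g′ = η + 2 α m′² ≥ η: the inequality 2 z g g′ < α τ η survives lowering g′ to η, and
        -- η > 0 cancels.
        0<D : 0# < α * τ - 2# * (z * g)
        0<D = *-cancelˡ-pos (proj₁ 0<η) (>0-resp
          (+-pos-nonNeg E<0 (*-nonNegative (*-nonNegative (proj₁ 0<2) (*-nonNegative 0≤z (U-weight-nonNeg n)))
            (*-nonNegative (proj₁ 0<2) (*-nonNegative 0≤α (0≤x² m′)))))
          (solve 5 (λ α β k z τ →
              let m = :1 :+ k ; m′ = :1 :+ m ; m″ = :1 :+ m′
                  g = :2 :* (α :* m) :+ β :* m′ ; g′ = :2 :* (α :* m′) :+ β :* m″
                  η = β :* m″ :- :2 :* (α :* (m :* m′)) in
              :- (:2 :* (z :* (g :* g′)) :- α :* τ :* η) :+ :2 :* (z :* g) :* (:2 :* (α :* (m′ :* m′)))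
              := η :* (α :* τ :- :2 :* (z :* g))) refl α β (fromℕ n) z τ))
        -- Positivity of η bounds α by g, which turns α τ > 2 z g into τ > 4 z m m′, exactly the
        -- threshold of `BU-estimate`.
        0≤d : 0# ≤ g - 2# * (m * m′ * α)
        0≤d = *-cancelˡ-nonNeg (fromℕ-pos (suc (suc n))) (≥0-resp
          (+-nonNeg (*-nonNegative (proj₁ 0<2) (*-nonNegative 0≤α (fromℕ-nonNeg (suc n))))
                    (*-nonNegative (fromℕ-nonNeg (suc (suc n))) (proj₁ 0<η)))
          (solve 3 (λ α β k →
              let m = :1 :+ k ; m′ = :1 :+ m ; m″ = :1 :+ m′
                  g = :2 :* (α :* m) :+ β :* m′ ; η = β :* m″ :- :2 :* (α :* (m :* m′)) in
              :2 :* (α :* m) :+ m′ :* η := m″ :* (g :- :2 :* (m :* m′ :* α))) refl α β (fromℕ n)))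
        0<τ-4zmm′ : 0# < τ - 2# * (2# * (z * (m * m′)))
        0<τ-4zmm′ = *-cancelˡ-pos 0≤α (>0-resp
          (+-pos-nonNeg 0<D (*-nonNegative (proj₁ 0<2) (*-nonNegative 0≤z 0≤d)))
          (solve 6 (λ α τ z g m m′ → 
              α :* τ :- :2 :* (z :* g) :+ :2 :* (z :* (g :- :2 :* (m :* m′ :* α)))
              := α :* (τ :- :2 :* (:2 :* (z :* (m :* m′))))) refl α τ z g m m′))
        estimate = BU-estimate (suc n) x x≤0 0<τ (proj₁ 0<τ-4zmm′)
        -- This is `BU-relation` multiplied by T · T ^ suc n; adding and subtracting 2 z g m m′ T ^
        -- suc n B splits it into the two parts whose signs are known.
        0<sum : 0# < m * m′ * (T ^ suc n * B (suc n) x) * (α * τ - 2# * (z * g))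
                     + g * (T * T ^ suc n * U (suc n) x + 2# * (z * (m * m′)) * (T ^ suc n * B (suc n) x))
        0<sum = +-pos-nonNeg
          (*-pos (*-pos (*-pos (fromℕ-pos n) (fromℕ-pos (suc n))) (proj₁ estimate)) 0<D)
          (*-nonNegative (U-weight-nonNeg n) (proj₂ estimate))

      F-nonNeg : ∀ n {x} → 0# ≤ x → 0# ≤ eval (F α β (suc (suc n))) x
      F-nonNeg n {x} 0≤x = *-cancelˡ-nonNeg (fromℕ-pos n) (*-cancelˡ-nonNeg (fromℕ-pos (suc n))
        (≥0-resp (+-nonNeg
          (*-nonNegative (*-nonNegative (fromℕ-nonNeg (suc n)) (fromℕ-nonNeg (suc (suc n))))
            (*-nonNegative 0≤α (*-nonNegative (+-nonNeg (proj₁ 0<1) 0≤x) (proj₁ (proj₁ (BU-pos (suc n) 0≤x))))))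
          (*-nonNegative (U-weight-nonNeg n) (proj₂ (BU-pos (suc n) 0≤x)))) (sym (F-BU n x))))

      F-zero-nonPositive : ∀ n {x} → 0# < U-weight n → eval (F α β (suc (suc n))) x ≈ 0# → x ≤ 0#
      F-zero-nonPositive n {x} 0<g f≈0 = ≯0⇒≤0 (λ 0<x → ≉0
        (+-pos-nonNeg (*-pos 0<g (U-pos n 0<x))
          (*-nonNegative (*-nonNegative (fromℕ-nonNeg (suc n)) (fromℕ-nonNeg (suc (suc n))))
            (*-nonNegative 0≤α (*-nonNegative (+-nonNeg (proj₁ 0<1) (proj₁ 0<x))
              (proj₁ (proj₁ (BU-pos (suc n) (proj₁ 0<x))))))))
        (trans (+-comm _ _) (BU-relation n x f≈0)))

      -- Degree and leading coefficients are parameters so that α = 0, where all degrees are one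
      -- lower, is treated together with α > 0. In both cases e fits one of the two degrees of
      -- `interlacing-zeros` for the n + 1 zeros of B.
      interlaces : ∀ n {e a a′} → 0# < U-weight n → 0# < a → 0# < a′ →
        HasLeading a e (F α β (suc (suc n))) → HasLeading a′ (suc e) (F α β (suc (suc (suc n)))) →
        e ≡ suc n ⊎ e ≡ suc (suc n) →
        F α β (suc (suc n)) ≼ F α β (suc (suc (suc n)))
      interlaces n {e} {a} {a′} 0<g 0<a 0<a′ lead lead′ e≡ =
        ss , proj₁ found′ , (a , 0<a , factored-F) , (a′ , 0<a′ , proj₁ (proj₂ (proj₂ found′)))
          , interlace (proj₂ (proj₂ (proj₂ found′)))
        where
        open ZerosOfB (zerosOfB (suc n))
        m = fromℕ (suc n)
        m′ = fromℕ (suc (suc n))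
        m″ = fromℕ (suc (suc (suc n)))
        f = eval (F α β (suc (suc n)))
        f′ = eval (F α β (suc (suc (suc n))))
        at-B-zero : ∀ {r} → B (suc n) r ≈ 0# → m′ * (m * f r) ≈ U-weight n * U (suc n) r
        at-B-zero {r} b≈0 = trans (F-BU n r) (lincomb b≈0
          (solve 5 (λ p α T b v → p :* (α :* (T :* b)) :+ v :- v := (p :* (α :* T)) :* (b :- :0))
            refl (m * m′) α (1# + r) (B (suc n) r) (U-weight n * U (suc n) r)))
        count-F : ∀ {e} → e ≡ suc n ⊎ e ≡ suc (suc n) → e ≡ length zeros ⊎ e ≡ suc (length zeros)
        count-F (inj₁ e≡) = inj₁ (≡.trans e≡ (≡.sym count))
        count-F (inj₂ e≡) = inj₂ (≡.trans e≡ (≡.cong suc (≡.sym count)))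
        found = interlacing-zeros 0<a zeros (F α β (suc (suc n))) {1#} (count-F e≡) lead decreasing
          ( F-nonNeg n (proj₁ 0<1)
          , alternates-follows (All.map (λ {r} b≈0 → m′ * m , U-weight n
              , *-pos (fromℕ-pos (suc n)) (fromℕ-pos n) , proj₁ 0<g
              , lincomb (at-B-zero b≈0) (solve 5 (λ m m′ f g u → m′ :* m :* (:- f) :- g :* (:- u)
                  := (:- :1) :* (m′ :* (m :* f) :- g :* u)) refl m m′ (f r) (U-weight n) (U (suc n) r)))
              vanishes) U-alternates)
        ss = proj₁ found
        factored-F = proj₁ (proj₂ (proj₂ found))
        inter = proj₂ (proj₂ (proj₂ found))
        f-vanishes : All (λ s → f s ≈ 0#) ss
        f-vanishes = factored-zeros (F α β (suc (suc n))) a factored-F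
        f-nonPositive : All (_≤ 0#) ss
        f-nonPositive = All.map (F-zero-nonPositive n 0<g) f-vanishes
        f-decreasing : Decreasing ss
        f-decreasing = interleaved-decreasing (λ x → f x ≈ 0#)
          (λ x≈y e → trans (eval-congˣ (F α β (suc (suc n))) (sym x≈y)) e) inter f-vanishes
          -- A common zero of F and B would force g U = 0, impossible for g > 0.
          (All.zipWith (λ {r} (b≈0 , u≉0) f≈0 → u≉0 (x*y≈0⇒y≈0 (≉0 0<g)
            (trans (sym (at-B-zero b≈0)) (trans (*-congˡ (trans (*-congˡ f≈0) (zeroʳ m))) (zeroʳ m′)))))
            (vanishes , U-nonZero))
        follows : ∀ s → f s ≈ 0# → s ≤ 0# → Follows (eval ∏[X- zeros ]) (λ x → - f′ x) s
        follows s f≈0 s≤0 = U-weight n * (m″ * m′) , m′ * E n s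
          , *-pos 0<g (*-pos (fromℕ-pos (suc (suc n))) (fromℕ-pos (suc n)))
          , *-nonNegative (fromℕ-nonNeg (suc (suc n))) (E-nonNeg n s s≤0 f≈0)
          , trans (lincomb (F-next-at-zero n s f≈0)
              (solve 5 (λ g p q f l → g :* (p :* q) :* (:- f) :- l
                 := (:- :1) :* (g :* (p :* (q :* f)) :- :- l)) refl (U-weight n) m″ m′ (f′ s) _))
              (*-congˡ (B-factored s))
        found′ = interlacing-zeros 0<a′ ss (F α β (suc (suc (suc n)))) {1#}
          (inj₂ (≡.cong suc (≡.sym (proj₁ (proj₂ found))))) lead′
          (All.map ≤0⇒<1 f-nonPositive ∷ f-decreasing)
          ( F-nonNeg (suc n) (proj₁ 0<1)
          , alternates-follows (All.zipWith (λ {s} (f≈0 , s≤0) → follows s f≈0 s≤0) (f-vanishes , f-nonPositive))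
              (∏-alternates inter))

  -- The exceptional pair F₂, F₃ for α + β = 0.

  X-*ᴾ-comm : ∀ r s p → (X- r) *ᴾ ((X- s) *ᴾ p) ≈ᴾ (X- s) *ᴾ ((X- r) *ᴾ p)
  X-*ᴾ-comm r s p zero = trans (expand r s) (trans
      (solve 3 (λ r s a → (:- r) :* ((:- s) :* a) := (:- s) :* ((:- r) :* a)) refl r s _) (sym (expand s r)))
    where
    expand : ∀ r s → coeff ((X- r) *ᴾ ((X- s) *ᴾ p)) 0 ≈ - r * (- s * coeff p 0)
    expand r s = trans (coeff-X-*ᴾ-zero r ((X- s) *ᴾ p)) (*-congˡ (coeff-X-*ᴾ-zero s p))
  X-*ᴾ-comm r s p (suc zero) = trans (expand r s) (trans
      (solve 4 (λ r s a b → (:- s) :* a :- r :* (a :- s :* b) := (:- r) :* a :- s :* (a :- r :* b)) refl r s _ _)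
      (sym (expand s r)))
    where
    expand : ∀ r s → coeff ((X- r) *ᴾ ((X- s) *ᴾ p)) 1 ≈ - s * coeff p 0 - r * (coeff p 0 - s * coeff p 1)
    expand r s = trans (coeff-X-*ᴾ-suc r ((X- s) *ᴾ p) 0)
      (+-cong (coeff-X-*ᴾ-zero s p) (-‿cong (*-congˡ (coeff-X-*ᴾ-suc s p 0))))
  X-*ᴾ-comm r s p (suc (suc k)) = trans (expand r s) (trans
      (solve 5 (λ r s a b c → a :- s :* b :- r :* (b :- s :* c) := a :- r :* b :- s :* (b :- r :* c)) refl r s _ _ _)
      (sym (expand s r)))
    where
    expand : ∀ r s → coeff ((X- r) *ᴾ ((X- s) *ᴾ p)) (suc (suc k)) ≈
             coeff p k - s * coeff p (suc k) - r * (coeff p (suc k) - s * coeff p (suc (suc k)))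
    expand r s = trans (coeff-X-*ᴾ-suc r ((X- s) *ᴾ p) (suc k))
      (+-cong (coeff-X-*ᴾ-suc s p k) (-‿cong (*-congˡ (coeff-X-*ᴾ-suc s p (suc k)))))

  -- For β = −α, F₂ = α (1 + x)² has a double zero, which F₃ = α (1 + x)(1 + 5x + x²)
  -- shares.
  F₂≼F₃ : ∀ {α β} → 0# < α → α + β ≈ 0# → F α β 2 ≼ F α β 3
  F₂≼F₃ {α} {β} 0<α α+β≈0 = from-quadratic (interlacing-zeros 0<α (- 1# ∷ []) quadratic {1#} (inj₂ ≡.refl)
      (refl , λ { (suc zero) (s≤s ()) ; (suc (suc zero)) (s≤s (s≤s ())) ; (suc (suc (suc k))) _ → refl }) (((-1≤1 , -1≉1) ∷ []) ∷ ([] ∷ []))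
      -- The quadratic is 7 α at 1 and -3 α at -1, so -1 separates its two zeros.
      ( ≥0-resp (+-nonNeg (proj₁ 0<α) (+-nonNeg 0≤5α (proj₁ 0<α)))
          (solve 1 (λ α → α :+ (five :* α :+ α) := α :+ :1 :* (five :* α :+ :1 :* (α :+ :1 :* :0))) refl α)
      , ≥0-resp (+-nonNeg (proj₁ 0<α) (+-nonNeg (proj₁ 0<α) (proj₁ 0<α)))
          (solve 1 (λ α → α :+ (α :+ α) := :- (α :+ (:- :1) :* (five :* α :+ (:- :1) :* (α :+ (:- :1) :* :0)))) refl α)
      , tt ))
    where
    five : ∀ {n} → _
    five {n} = :1 {n} :+ :1 :+ :1 :+ :1 :+ :1
    5# = 1# + 1# + 1# + 1# + 1#
    0≤5α : 0# ≤ 5# * α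
    0≤5α = *-nonNegative (+-nonNeg (+-nonNeg (+-nonNeg (proj₁ 0<2) (proj₁ 0<1)) (proj₁ 0<1)) (proj₁ 0<1)) (proj₁ 0<α)
    quadratic : Poly
    quadratic = α ∷ 5# * α ∷ α ∷ []
    -1≤1 : - 1# ≤ 1#
    -1≤1 = 0≤-⇒≤ (≥0-resp (proj₁ 0<2) (solve 0 (:1 :+ :1 := :1 :- :- :1) refl))
    -1≉1 : ¬ - 1# ≈ 1#
    -1≉1 e = ≉0 0<2 (lincomb e (solve 0 (:1 :+ :1 :- :0 := (:- :1) :* (:- :1 :- :1)) refl))
    F₂-factored : F α β 2 ≈ᴾ α ·ᴾ ∏[X- - 1# ∷ - 1# ∷ [] ]
    F₂-factored zero = solve 2 (λ α β → let f₁ = :1 :+ :0 ; f₂ = :1 :+ f₁ ; q₀ = (:- :- :1) :* :1 :+ :0 in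
      α :* (f₁ :* f₁) :+ β :* f₂ :* :0 := α :* ((:- :- :1) :* q₀ :+ :0)) refl α β
    F₂-factored (suc zero) = lincomb₂ (⁻¹-inverseʳ (fromℕ 1) (≉0 (fromℕ-pos 0))) α+β≈0
      (solve 3 (λ α β i → let f₁ = :1 :+ :0 ; f₂ = :1 :+ f₁ ; q₀ = (:- :- :1) :* :1 :+ :0 ; q₁ = :1 :* :1 :+ :0 in
        α :* (f₂ :* f₂) :+ β :* f₂ :* (i :* (f₁ :* f₁)) :- α :* ((:- :- :1) :* q₁ :+ (:1 :* q₀ :+ :0))
          := (:2 :* β) :* (f₁ :* i :- :1) :+ :2 :* (α :+ β :- :0)) refl α β (fromℕ 1 ⁻¹))
    F₂-factored (suc (suc zero)) = solve 1 (λ α → let f₁ = :1 :+ :0 ; q₁ = :1 :* :1 :+ :0 in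
      α :* (f₁ :* f₁) := α :* (:1 :* q₁)) refl α
    F₂-factored (suc (suc (suc k))) = refl
    F₃-factored : F α β 3 ≈ᴾ (X- (- 1#)) *ᴾ quadratic
    F₃-factored zero = solve 2 (λ α β → let f₁ = :1 :+ :0 ; f₃ = :1 :+ (:1 :+ f₁) in
      α :* (f₁ :* f₁) :+ β :* f₃ :* :0 := (:- :- :1) :* α :+ :0) refl α β
    F₃-factored (suc zero) = lincomb₂ (⁻¹-inverseʳ (fromℕ 2) (≉0 (fromℕ-pos 1))) α+β≈0
      (solve 3 (λ α β i → let f₁ = :1 :+ :0 ; f₂ = :1 :+ f₁ ; f₃ = :1 :+ f₂ in
        α :* (f₃ :* f₃) :+ β :* f₃ :* (i :* (f₁ :* f₂)) :- ((:- :- :1) :* (five :* α) :+ (:1 :* α :+ :0))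
          := (f₃ :* β) :* (f₂ :* i :- :1) :+ f₃ :* (α :+ β :- :0)) refl α β (fromℕ 2 ⁻¹))
    F₃-factored (suc (suc zero)) = lincomb₂ (⁻¹-inverseʳ (fromℕ 2) (≉0 (fromℕ-pos 1))) α+β≈0
      (solve 3 (λ α β i → let f₁ = :1 :+ :0 ; f₂ = :1 :+ f₁ ; f₃ = :1 :+ f₂ in
        α :* (f₃ :* f₃) :+ β :* f₃ :* (i :* (f₂ :* f₁)) :- ((:- :- :1) :* α :+ :1 :* (five :* α))
          := (f₃ :* β) :* (f₂ :* i :- :1) :+ f₃ :* (α :+ β :- :0)) refl α β (fromℕ 2 ⁻¹))
    F₃-factored (suc (suc (suc zero))) = solve 1 (λ α → let f₁ = :1 :+ :0 in
      α :* (f₁ :* f₁) := :1 :* α) refl α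
    F₃-factored (suc (suc (suc (suc k)))) = refl
    from-quadratic : ∃ (λ rs → length rs ≡ 2 × quadratic ≈ᴾ α ·ᴾ ∏[X- rs ] × Interleaved 1# rs (- 1# ∷ [])) →
                     F α β 2 ≼ F α β 3
    from-quadratic (r ∷ s ∷ [] , _ , q≈ , (r≤1 ∷ -1≤r ∷ s≤-1 ∷ [])) =
      -- The zero -1 split off from F₃ lies between r and s, so its factor is moved to the second
      -- place to keep the list in descending order.
      - 1# ∷ - 1# ∷ [] , r ∷ - 1# ∷ s ∷ [] , (α , 0<α , F₂-factored) ,
      (α , 0<α , λ k → trans (F₃-factored k) (trans (X-*ᴾ-cong (- 1#) {quadratic} {α ·ᴾ ∏[X- r ∷ s ∷ [] ]} q≈ k)
        (trans (X-*ᴾ-·ᴾ (- 1#) α ∏[X- r ∷ s ∷ [] ] k)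
          (trans (coeff-·ᴾ α ((X- (- 1#)) *ᴾ ∏[X- r ∷ s ∷ [] ]) k) (trans (*-congˡ (X-*ᴾ-comm (- 1#) r ∏[X- s ∷ [] ] k))
            (sym (coeff-·ᴾ α ∏[X- r ∷ - 1# ∷ s ∷ [] ] k))))))) ,
      interlace (r≤1 ∷ -1≤r ∷ ≤.refl ∷ ≤.refl ∷ s≤-1 ∷ [])

-- The theorem, by cases on α and α + β.

mainTheorem2 : ∀ {c ℓ₁ ℓ₂} (ℝ : RealField c ℓ₁ ℓ₂) →
    let open RealField ℝ
        open Interlacing ℝ
        open Narayana ℝ
    in
    (α β : Carrier) → 0# ≤ α → 0# ≤ α + β → ¬ (α ≈ 0# × β ≈ 0#) →
    (n : ℕ) → 2 ≤ℕ n →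
    F α β n ≼ F α β (suc n)
mainTheorem2 ℝ α β 0≤α 0≤α+β αβ≉0 (suc (suc n)) (s≤s (s≤s z≤n)) = cases (>0-or-≈0 0≤α) (>0-or-≈0 0≤α+β) n
  where
  open RealField ℝ
  open Interlacing ℝ
  open Narayana ℝ
  open OrderedField ℝ
  open Recurrences ℝ
  open InterlacingF ℝ

  α≈0⇒β≈α+β : α ≈ 0# → β ≈ α + β
  α≈0⇒β≈α+β α≈0 = sym (trans (+-congʳ α≈0) (+-identityˡ β))

  α>0-case : 0# < α → ∀ n → 0# < U-weight α β n → F α β (suc (suc n)) ≼ F α β (suc (suc (suc n)))
  α>0-case 0<α n 0<g = interlaces α β 0≤α 0≤α+β n 0<g 0<α 0<α
    (F-leading α β n) (F-leading α β (suc n)) (inj₂ ≡.refl)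

  cases : 0# < α ⊎ α ≈ 0# → 0# < α + β ⊎ α + β ≈ 0# → ∀ n →
          F α β (suc (suc n)) ≼ F α β (suc (suc (suc n)))
  cases (inj₁ 0<α) (inj₁ 0<α+β) n = α>0-case 0<α n (>0-resp
    (+-pos-nonNeg (*-pos (fromℕ-pos (suc n)) 0<α+β) (*-nonNegative (fromℕ-nonNeg n) 0≤α))
    (U-weight-split α β n))
  cases (inj₁ 0<α) (inj₂ α+β≈0) zero    = F₂≼F₃ 0<α α+β≈0
  -- The positive part of g is here the second summand of `U-weight-split`, whose factor is now n +
  -- 1.
  cases (inj₁ 0<α) (inj₂ α+β≈0) (suc n) = α>0-case 0<α (suc n) (>0-resp
    (+-pos-nonNeg (*-pos (fromℕ-pos n) 0<α) (*-nonNegative (fromℕ-nonNeg (suc (suc (suc n)))) 0≤α+β))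
    (trans (+-comm _ _) (U-weight-split α β (suc n))))
  cases (inj₂ α≈0) (inj₁ 0<α+β) n = interlaces α β 0≤α 0≤α+β n
    (>0-resp (+-pos-nonNeg (*-pos (fromℕ-pos (suc n)) 0<α+β) (*-nonNegative (fromℕ-nonNeg n) 0≤α))
      (U-weight-split α β n))
    (*-pos 0<β (fromℕ-pos (suc n))) (*-pos 0<β (fromℕ-pos (suc (suc n))))
    (F-leading-0 β n α≈0) (F-leading-0 β (suc n) α≈0) (inj₁ ≡.refl)
    where
    0<β : 0# < β
    0<β = >0-resp 0<α+β (sym (α≈0⇒β≈α+β α≈0))
  cases (inj₂ α≈0) (inj₂ α+β≈0) n = ⊥-elim (αβ≉0 (α≈0 , trans (α≈0⇒β≈α+β α≈0) α+β≈0))
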